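{- Let $X$ be a compact geodesic space and let $k\ge 1$ be the number of cops. For every $\varepsilon>0$ and $T>0$, there exist an integer $N$ and a finite agility $\tau^N:\{1,\dots,N\}\to\mathbb R_+$ with $T_N(\tau)=\sum_{n=1}^N\tau(n)\ge T$ such that for every initial position $(r,c)\in X^{k+1}$ we have $$\mathrm{Val}(r,c)-\varepsilon<\mathrm{Val}(r,c,N,\tau^N)<\mathrm{Val}(r,c)+\varepsilon.$$
   Context: $X$ is a compact geodesic space with metric $d$ (any two points $x,y$ are joined by a path of length $d(x,y)$). Positions are tuples $(r,c)=(r,c_1,\dots,c_k)\in X^{k+1}$. Put $d(r,c)=\min_i d(r,c_i)$ and $d(c,c')=\max_i d(c_i,c_i')$. An agility is a function $\tau:\mathbb N=\{1,2,\dots\}\to\mathbb R_+=[0,\infty)$; $\tau^N$ denotes its restriction to $\{1,\dots,N\}$, $T_N(\tau)=\sum_{n=1}^N\tau(n)$, and $\tau_1$ is the shift $\tau_1(i)=\tau(i+1)$. The value of the finite $N$-step game is defined recursively by $\mathrm{Val}(r,c,0,\tau^0)=d(r,c)$ and, for $N\ge1$, $$\mathrm{Val}(r,c,N,\tau^N)=\max_{r':\,d(r,r')\le\tau(1)}\ \min_{c':\,d(c,c')\le\tau(1)}\mathrm{Val}(r',c',N-1,\tau_1^{N-1})$$ (maximum and minimum are attained). For $T>0$ put $$\mathrm{Val}(r,c,T)=\sup_{N,\tau:\ T_N(\tau)=T}\mathrm{Val}(r,c,N,\tau^N),\qquad \mathrm{Val}(r,c)=\inf_{T>0}\mathrm{Val}(r,c,T).$$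 ($\mathrm{Val}(r,c,T)$ is non-increasing in $T$, so the infimum is the limit as $T\to\infty$.) -}

module Defs where

open import Algebra.Bundles using (CommutativeMonoid)
import Algebra.Properties.CommutativeSemigroup as CommutativeSemigroupProperties
open import Data.Fin.Base using (Fin; zero; suc; fromℕ; inject₁)
open import Data.List.Base using (List)
open import Data.List.Relation.Unary.Any using (Any)
open import Data.Nat.Base as ℕ using (ℕ; zero; suc; NonZero)
import Data.Nat.Properties as ℕ
open import Data.Product.Base using (∃; ∃₂; _×_; _,_; proj₁; proj₂)
open import Data.Rational.Base as ℚ using (ℚ; 0ℚ; 1ℚ; ½)
import Data.Rational.Properties as ℚ
open import Data.Vec.Functional using (Vector; head; tail; foldr; map; zipWith)
open import Function.Metric.Structures using (IsGeneralMetric)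
open import Level using (Level; 0ℓ) renaming (suc to lsuc; _⊔_ to _⊔ˡ_)
open import Relation.Binary.Core using (Rel)
open import Relation.Binary.PropositionalEquality using (_≡_; refl; sym; trans; cong; subst)
open import Relation.Unary using (Pred)

-- Reals are Cauchy sequences of rationals, up to the setoid equality _≃_.
-- The condition is symmetric in m and n, so it says ∣ x m - x n ∣ ≤ ε.
IsCauchy : (ℕ → ℚ) → Set
IsCauchy x = ∀ ε → 0ℚ ℚ.< ε →
  ∃ λ N → ∀ m n → N ℕ.≤ m → N ℕ.≤ n → x m ℚ.≤ x n ℚ.+ ε

record ℝ : Set where
  constructor mkℝ
  field
    seq    : ℕ → ℚ
    cauchy : IsCauchy seq

open ℝ public

infix 4 _≤_ _<_ _≃_

_≤_ : Rel ℝ 0ℓ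
x ≤ y = ∀ ε → 0ℚ ℚ.< ε → ∃ λ N → ∀ n → N ℕ.≤ n → seq x n ℚ.≤ seq y n ℚ.+ ε

_<_ : Rel ℝ 0ℓ
x < y = ∃ λ ε → 0ℚ ℚ.< ε × ∃ λ N → ∀ n → N ℕ.≤ n → seq x n ℚ.+ ε ℚ.≤ seq y n

_≃_ : Rel ℝ 0ℓ
x ≃ y = x ≤ y × y ≤ x

fromℚ : ℚ → ℝ
fromℚ q = mkℝ (λ _ → q) λ ε 0<ε → 0 , λ _ _ _ _ →
  subst (ℚ._≤ q ℚ.+ ε) (ℚ.+-identityʳ q) (ℚ.+-monoʳ-≤ q (ℚ.<⇒≤ 0<ε))

0ℝ 1ℝ : ℝ
0ℝ = fromℚ 0ℚ
1ℝ = fromℚ 1ℚ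

private
  half-pos : ∀ {ε} → 0ℚ ℚ.< ε → 0ℚ ℚ.< ε ℚ.* ½
  half-pos {ε} 0<ε =
    subst (ℚ._< ε ℚ.* ½) (ℚ.*-zeroˡ ½) (ℚ.*-monoˡ-<-pos ½ 0<ε)

  ½+½≡1 : ½ ℚ.+ ½ ≡ 1ℚ
  ½+½≡1 = refl

  halves : ∀ ε → ε ℚ.* ½ ℚ.+ ε ℚ.* ½ ≡ ε
  halves ε = trans (sym (ℚ.*-distribˡ-+ ε ½ ½)) (trans (cong (ε ℚ.*_) ½+½≡1) (ℚ.*-identityʳ ε))

  regroup : ∀ a b ε → (a ℚ.+ ε ℚ.* ½) ℚ.+ (b ℚ.+ ε ℚ.* ½) ≡ (a ℚ.+ b) ℚ.+ ε
  regroup a b ε = trans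
    (interchange a (ε ℚ.* ½) b (ε ℚ.* ½)) (cong ((a ℚ.+ b) ℚ.+_) (halves ε))
    where open CommutativeSemigroupProperties
            (CommutativeMonoid.commutativeSemigroup ℚ.+-0-commutativeMonoid)

  cancel : ∀ b ε → ℚ.- (b ℚ.+ ε) ℚ.+ ε ≡ ℚ.- b
  cancel b ε = trans (cong (ℚ._+ ε) (ℚ.neg-distrib-+ b ε))
    (trans (ℚ.+-assoc (ℚ.- b) (ℚ.- ε) ε)
    (trans (cong (ℚ.- b ℚ.+_) (ℚ.+-inverseˡ ε)) (ℚ.+-identityʳ (ℚ.- b))))

  neg-swap : ∀ {a b} ε → a ℚ.≤ b ℚ.+ ε → ℚ.- b ℚ.≤ ℚ.- a ℚ.+ ε
  neg-swap {a} {b} ε a≤b+ε = subst (ℚ._≤ ℚ.- a ℚ.+ ε) (cancel b ε)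
    (ℚ.+-monoˡ-≤ ε (ℚ.neg-antimono-≤ a≤b+ε))

infix  8 -_
infixl 7 _⊓_
infixl 6 _+_ _-_ _⊔_

_+_ : ℝ → ℝ → ℝ
x + y = mkℝ (λ n → seq x n ℚ.+ seq y n) λ ε 0<ε →
  let M , p = cauchy x (ε ℚ.* ½) (half-pos 0<ε)
      N , q = cauchy y (ε ℚ.* ½) (half-pos 0<ε)
  in M ℕ.⊔ N , λ m n M⊔N≤m M⊔N≤n →
     subst (seq x m ℚ.+ seq y m ℚ.≤_) (regroup (seq x n) (seq y n) ε)
       (ℚ.+-mono-≤ (p m n (ℕ.m⊔n≤o⇒m≤o M N M⊔N≤m) (ℕ.m⊔n≤o⇒m≤o M N M⊔N≤n))
                   (q m n (ℕ.m⊔n≤o⇒n≤o M N M⊔N≤m) (ℕ.m⊔n≤o⇒n≤o M N M⊔N≤n)))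

-_ : ℝ → ℝ
- x = mkℝ (λ n → ℚ.- seq x n) λ ε 0<ε →
  let N , p = cauchy x ε 0<ε
  in N , λ m n N≤m N≤n → neg-swap ε (p n m N≤n N≤m)

_-_ : ℝ → ℝ → ℝ
x - y = x + (- y)

_⊓_ : ℝ → ℝ → ℝ
x ⊓ y = mkℝ (λ n → seq x n ℚ.⊓ seq y n) λ ε 0<ε →
  let M , p = cauchy x ε 0<ε
      N , q = cauchy y ε 0<ε
  in M ℕ.⊔ N , λ m n M⊔N≤m M⊔N≤n →
     subst (seq x m ℚ.⊓ seq y m ℚ.≤_)
       (sym (ℚ.mono-≤-distrib-⊓ (ℚ.+-monoˡ-≤ ε) (seq x n) (seq y n)))
       (ℚ.⊓-mono-≤ (p m n (ℕ.m⊔n≤o⇒m≤o M N M⊔N≤m) (ℕ.m⊔n≤o⇒m≤o M N M⊔N≤n))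
                   (q m n (ℕ.m⊔n≤o⇒n≤o M N M⊔N≤m) (ℕ.m⊔n≤o⇒n≤o M N M⊔N≤n)))

_⊔_ : ℝ → ℝ → ℝ
x ⊔ y = mkℝ (λ n → seq x n ℚ.⊔ seq y n) λ ε 0<ε →
  let M , p = cauchy x ε 0<ε
      N , q = cauchy y ε 0<ε
  in M ℕ.⊔ N , λ m n M⊔N≤m M⊔N≤n →
     subst (seq x m ℚ.⊔ seq y m ℚ.≤_)
       (sym (ℚ.mono-≤-distrib-⊔ (ℚ.+-monoˡ-≤ ε) (seq x n) (seq y n)))
       (ℚ.⊔-mono-≤ (p m n (ℕ.m⊔n≤o⇒m≤o M N M⊔N≤m) (ℕ.m⊔n≤o⇒m≤o M N M⊔N≤n))
                   (q m n (ℕ.m⊔n≤o⇒n≤o M N M⊔N≤m) (ℕ.m⊔n≤o⇒n≤o M N M⊔N≤n)))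

∣_∣ : ℝ → ℝ
∣ x ∣ = x ⊔ (- x)

sum : ∀ {n} → Vector ℝ n → ℝ
sum = foldr _+_ 0ℝ

minimum maximum : ∀ {n} .{{_ : NonZero n}} → Vector ℝ n → ℝ
minimum {suc _} v = foldr _⊓_ (head v) (tail v)
maximum {suc _} v = foldr _⊔_ (head v) (tail v)

module _ {a : Level} (S : Pred ℝ a) where

  IsUpperBound IsLowerBound IsMax IsMin IsSup IsInf : Pred ℝ a
  IsUpperBound b = ∀ x → S x → x ≤ b
  IsLowerBound b = ∀ x → S x → b ≤ x
  IsMax m = S m × IsUpperBound m
  IsMin m = S m × IsLowerBound m
  IsSup s = IsUpperBound s × (∀ b → IsUpperBound b → s ≤ b)
  IsInf s = IsLowerBound s × (∀ b → IsLowerBound b → b ≤ s)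

ℝ₊ : Set
ℝ₊ = ∃ λ x → 0ℝ ≤ x

𝕀 : Set
𝕀 = ∃ λ t → 0ℝ ≤ t × t ≤ 1ℝ

record MetricSpace (a ℓ : Level) : Set (lsuc (a ⊔ˡ ℓ)) where
  infix 4 _≈_
  field
    Carrier  : Set a
    _≈_      : Rel Carrier ℓ
    d        : Carrier → Carrier → ℝ
    isMetric : IsGeneralMetric _≈_ _≃_ _≤_ 0ℝ _+_ d

module _ {a ℓ : Level} (M : MetricSpace a ℓ) where
  open MetricSpace M

  IsOpen : Pred (Pred Carrier a) a
  IsOpen U = ∀ x → U x → ∃ λ ε → 0ℝ < ε × (∀ y → d x y < ε → U y)

  IsCompact : Set (lsuc a)
  IsCompact = (I : Set a) (U : I → Pred Carrier a) →
    (∀ i → IsOpen (U i)) → (∀ x → ∃ λ i → U i x) →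
    ∃ λ (is : List I) → ∀ x → Any (λ i → U i x) is

  IsContinuous : (𝕀 → Carrier) → Set
  IsContinuous γ = ∀ s ε → 0ℝ < ε → ∃ λ δ → 0ℝ < δ ×
    (∀ t → ∣ proj₁ s - proj₁ t ∣ < δ → d (γ s) (γ t) < ε)

  -- 0 = t₀ ≤ t₁ ≤ … ≤ tₙ = 1
  IsPartition : (n : ℕ) → Vector 𝕀 (suc n) → Set
  IsPartition n t =
    proj₁ (t zero) ≃ 0ℝ × proj₁ (t (fromℕ n)) ≃ 1ℝ ×
    (∀ i → proj₁ (t (inject₁ i)) ≤ proj₁ (t (suc i)))

  IsLength : (𝕀 → Carrier) → Pred ℝ 0ℓ
  IsLength γ = IsSup λ s → ∃₂ λ n t → IsPartition n t ×
    s ≃ sum (λ (i : Fin n) → d (γ (t (inject₁ i))) (γ (t (suc i))))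

  IsPath : Carrier → Carrier → (𝕀 → Carrier) → Set ℓ
  IsPath x y γ = IsContinuous γ ×
    (∀ t → proj₁ t ≃ 0ℝ → γ t ≈ x) × (∀ t → proj₁ t ≃ 1ℝ → γ t ≈ y)

  IsGeodesic : Set (a ⊔ˡ ℓ)
  IsGeodesic = ∀ x y → ∃ λ γ → IsPath x y γ × IsLength γ (d x y)

FiniteAgility : ℕ → Set
FiniteAgility N = Vector ℝ₊ N

totalTime : ∀ {N} → FiniteAgility N → ℝ
totalTime τ = sum (map proj₁ τ)

module Game {a ℓ : Level} (M : MetricSpace a ℓ) (k : ℕ) .{{_ : NonZero k}} where
  open MetricSpace M renaming (Carrier to X)

  distToCops : X → Vector X k → ℝ
  distToCops r c = minimum (map (d r) c)

  distCops : Vector X k → Vector X k → ℝ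
  distCops c c′ = maximum (zipWith d c c′)

  -- Values are given by their graphs: IsVal r c N τ v says that
  -- Val(r,c,N,τ) exists (all maxima and minima being attained) and equals v.
  IsVal : X → Vector X k → (N : ℕ) → FiniteAgility N → Pred ℝ a
  IsValAfter : X → Vector X k → (N : ℕ) → FiniteAgility (suc N) → Pred ℝ a

  IsVal r c zero    τ v = Level.Lift a (v ≃ distToCops r c)
  IsVal r c (suc N) τ =
    IsMax λ w → ∃ λ r′ → d r r′ ≤ proj₁ (head τ) × IsValAfter r′ c N τ w

  -- The robber has already moved to r′, the cops are still at c.
  IsValAfter r′ c N τ =
    IsMin λ w → ∃ λ c′ → distCops c c′ ≤ proj₁ (head τ) × IsVal r′ c′ N (tail τ) w

  IsValWithin : X → Vector X k → ℝ → Pred ℝ a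
  IsValWithin r c T =
    IsSup λ v → ∃₂ λ N (τ : FiniteAgility N) → totalTime τ ≃ T × IsVal r c N τ v

  IsLimitVal : X → Vector X k → Pred ℝ a
  IsLimitVal r c = IsInf λ v → ∃ λ T → 0ℝ < T × IsValWithin r c T v

{-# OPTIONS --safe #-}
module Submission where

-- Splitting a step into two shorter ones can only help the robber: he still
-- reaches the end point of the long step, and the cops have learnt less when
-- they start to move.  Appending steps can only help the cops, since every cop
-- can follow the robber along a geodesic without increasing his distance.
-- Hence Val(r,c,T) is non-increasing in T, and any two agilities of the same
-- total time have a common refinement that is at least as good as both for the
-- robber, simultaneously at all positions.  All values are 1-Lipschitz in the
-- robber and in the cops, because in a geodesic space balls of equal radius
-- vary continuously with the centre.  So it suffices to treat a finite net of
-- positions: first take T so large that Val(·,T) is close to Val on the net,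
-- then a common refinement of agilities that are nearly optimal at its points.

open import Defs
open import Algebra.Bundles using (CommutativeMonoid)
import Algebra.Solver.CommutativeMonoid as CommutativeMonoidSolver
open import Axiom.ExcludedMiddle using (ExcludedMiddle)
open import Data.Empty using (⊥)
open import Data.Fin.Base using (zero; suc)
open import Data.Integer.Base as ℤ using (+_; -[1+_])
import Data.Integer.Properties as ℤ
open import Data.List.Base using (List; []; _∷_; _++_; length)
open import Data.List.Properties using (tabulate-lookup)
open import Data.List.Relation.Unary.All as All using (All; []; _∷_)
open import Data.List.Relation.Unary.Any as Any using (Any)
open import Data.Nat.Base as ℕ using (ℕ; zero; suc; NonZero)
import Data.Nat.Coprimality as Coprimality
import Data.Nat.Properties as ℕ
open import Data.Product.Base using (Σ; Σ-syntax; ∃; ∃-syntax; ∃₂; _×_; _,_; proj₁; proj₂; swap)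
open import Data.Rational.Base as ℚ using (ℚ; 0ℚ; 1ℚ; ½; mkℚ)
import Data.Rational.Properties as ℚ
open import Data.Rational.Solver using (module +-*-Solver)
import Data.Rational.Unnormalised.Base as ℚᵘ
import Data.Rational.Unnormalised.Properties as ℚᵘ
open import Data.Sum.Base using (_⊎_; inj₁; inj₂; [_,_]′)
open import Data.Vec.Functional as Vector using (Vector; head; tail; map; zipWith; toList; fromList)
open import Function.Metric.Structures using (IsGeneralMetric)
open import Level using (Level; Lift; lift; lower; 0ℓ)
open import Relation.Binary.Bundles using (Poset)
open import Relation.Binary.PropositionalEquality using (_≡_; refl; sym; trans; cong; subst; subst₂)
open import Relation.Nullary using (Dec; yes; no; contradiction)
open import Relation.Nullary.Decidable using (map′)
open import Relation.Unary using (Pred)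

open +-*-Solver using (solve; _:=_; _:+_; _:*_; :-_; con)

-- The Lipschitz constant must not grow with the number of steps: the net of positions is chosen
-- without knowing the agility, and nothing bounds the agility's length. Treating one step of the
-- game as an operator on 1-Lipschitz payoffs settles this, and also makes every maximum and minimum
-- of the recursion attained. The time has to be fixed before the agility because a common
-- refinement exists only for equal total times. Both choices follow one pattern: a parameter good
-- for a position stays good after being joined with any other parameter. Times are joined by
-- addition, agilities by common refinement. Values and limit values are relations, so their
-- existence is part of the claim: extrema over balls come from compactness, suprema and infima of
-- sets of reals from excluded middle. Compactness is given for X alone, and statements about tuples
-- are reached by induction on the coordinates rather than by covering a product.

half-pos : ∀ {ε} → 0ℚ ℚ.< ε → 0ℚ ℚ.< ε ℚ.* ½
half-pos {ε} 0<ε = subst (ℚ._< ε ℚ.* ½) (ℚ.*-zeroˡ ½) (ℚ.*-monoˡ-<-pos ½ 0<ε)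

ε/2+ε/2≡ε : ∀ ε → ε ℚ.* ½ ℚ.+ ε ℚ.* ½ ≡ ε
ε/2+ε/2≡ε = solve 1 (λ ε → ε :* con ½ :+ ε :* con ½ := ε) refl

+-halves : ∀ p ε → p ℚ.+ ε ℚ.* ½ ℚ.+ ε ℚ.* ½ ≡ p ℚ.+ ε
+-halves p ε = trans (ℚ.+-assoc p (ε ℚ.* ½) (ε ℚ.* ½)) (cong (p ℚ.+_) (ε/2+ε/2≡ε ε))

p≤p+q : ∀ p {q} → 0ℚ ℚ.< q → p ℚ.≤ p ℚ.+ q
p≤p+q p {q} 0<q = subst (ℚ._≤ p ℚ.+ q) (ℚ.+-identityʳ p) (ℚ.+-monoʳ-≤ p (ℚ.<⇒≤ 0<q))

Eventually : (ℕ → Set) → Set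
Eventually P = ∃ λ N → ∀ n → N ℕ.≤ n → P n

eventually₂ : ∀ {P Q R : ℕ → Set} → (∀ n → P n → Q n → R n) →
              Eventually P → Eventually Q → Eventually R
eventually₂ f (M , p) (N , q) = M ℕ.⊔ N , λ n M⊔N≤n →
  f n (p n (ℕ.m⊔n≤o⇒m≤o M N M⊔N≤n)) (q n (ℕ.m⊔n≤o⇒n≤o M N M⊔N≤n))

private
  +-cancelʳ-≤ : ∀ r {p q} → p ℚ.+ r ℚ.≤ q ℚ.+ r → p ℚ.≤ q
  +-cancelʳ-≤ r {p} {q} le = subst₂ ℚ._≤_ (lemma p r) (lemma q r) (ℚ.+-monoˡ-≤ (ℚ.- r) le)
    where lemma : ∀ p r → p ℚ.+ r ℚ.+ ℚ.- r ≡ p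
          lemma = solve 2 (λ p r → p :+ r :+ :- r := p) refl

  -- A Cauchy sequence stays within η of its N-th term from N on, so comparing
  -- the N-th terms decides the order up to a multiple of η.
  compare-up-to : ∀ x y η → 0ℚ ℚ.< η → (x < y → ⊥) →
    Eventually (λ n → seq y n ℚ.≤ seq x n ℚ.+ (η ℚ.+ (η ℚ.+ η ℚ.+ η) ℚ.+ η))
  compare-up-to x y η 0<η x≮y with cauchy x η 0<η | cauchy y η 0<η
  ... | K , cx | L , cy = N , bound (ℚ.≤-total (seq y N) (seq x N ℚ.+ (η ℚ.+ η ℚ.+ η)))
    where
    N = K ℕ.⊔ L
    K≤ : ∀ {n} → N ℕ.≤ n → K ℕ.≤ n
    K≤ = ℕ.m⊔n≤o⇒m≤o K L
    L≤ : ∀ {n} → N ℕ.≤ n → L ℕ.≤ n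
    L≤ = ℕ.m⊔n≤o⇒n≤o K L
    arith₁ : ∀ p η → p ℚ.+ η ℚ.+ (η ℚ.+ η ℚ.+ η) ℚ.+ η ≡ p ℚ.+ (η ℚ.+ (η ℚ.+ η ℚ.+ η) ℚ.+ η)
    arith₁ = solve 2 (λ p η → p :+ η :+ (η :+ η :+ η) :+ η := p :+ (η :+ (η :+ η :+ η) :+ η)) refl
    arith₂ : ∀ p η → p ℚ.+ η ℚ.+ η ℚ.+ η ≡ p ℚ.+ (η ℚ.+ η ℚ.+ η)
    arith₂ = solve 2 (λ p η → p :+ η :+ η :+ η := p :+ (η :+ η :+ η)) refl
    apart : seq x N ℚ.+ (η ℚ.+ η ℚ.+ η) ℚ.≤ seq y N → ∀ n → N ℕ.≤ n → seq x n ℚ.+ η ℚ.≤ seq y n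
    apart ge n N≤n = +-cancelʳ-≤ η (ℚ.≤-trans
      (ℚ.+-monoˡ-≤ η (ℚ.+-monoˡ-≤ η (cx n N (K≤ N≤n) (K≤ ℕ.≤-refl))))
      (ℚ.≤-trans (ℚ.≤-reflexive (arith₂ (seq x N) η))
      (ℚ.≤-trans ge (cy N n (L≤ ℕ.≤-refl) (L≤ N≤n)))))
    bound : seq y N ℚ.≤ seq x N ℚ.+ (η ℚ.+ η ℚ.+ η) ⊎ seq x N ℚ.+ (η ℚ.+ η ℚ.+ η) ℚ.≤ seq y N →
      ∀ n → N ℕ.≤ n → seq y n ℚ.≤ seq x n ℚ.+ (η ℚ.+ (η ℚ.+ η ℚ.+ η) ℚ.+ η)
    bound (inj₁ le) n N≤n = subst (seq y n ℚ.≤_) (arith₁ (seq x n) η)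
      (ℚ.≤-trans (cy n N (L≤ N≤n) (L≤ ℕ.≤-refl))
      (ℚ.+-monoˡ-≤ η (ℚ.≤-trans le (ℚ.+-monoˡ-≤ (η ℚ.+ η ℚ.+ η)
        (cx N n (K≤ ℕ.≤-refl) (K≤ N≤n))))))
    bound (inj₂ ge) = contradiction (η , 0<η , N , apart ge) x≮y

  fifth-pos : ∀ ε → 0ℚ ℚ.< ε → 0ℚ ℚ.< ε ℚ.* (+ 1 ℚ./ 5)
  fifth-pos ε 0<ε = subst (ℚ._< ε ℚ.* (+ 1 ℚ./ 5)) (ℚ.*-zeroˡ (+ 1 ℚ./ 5)) (ℚ.*-monoˡ-<-pos (+ 1 ℚ./ 5) 0<ε)

  -- The error in `compare-up-to` is the threshold of three η plus one η of drift for each sequence.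
  -- The threshold is three because drift consumes two and the third must survive as a witness of
  -- `x < y`.
  five-fifths : ∀ ε → let η = ε ℚ.* (+ 1 ℚ./ 5) in η ℚ.+ (η ℚ.+ η ℚ.+ η) ℚ.+ η ≡ ε
  five-fifths = solve 1 (λ ε → let η = ε :* con (+ 1 ℚ./ 5) in η :+ (η :+ η :+ η) :+ η := ε) refl

  ≮⇒≥ : ∀ x y → (x < y → ⊥) → y ≤ x
  ≮⇒≥ x y x≮y ε 0<ε = subst (λ δ → Eventually (λ n → seq y n ℚ.≤ seq x n ℚ.+ δ)) (five-fifths ε)
    (compare-up-to x y (ε ℚ.* (+ 1 ℚ./ 5)) (fifth-pos ε 0<ε) x≮y)

-- The ordered group of reals

-- The relations of Defs unfold to statements about sequences of rationals,
-- which hides the two reals from the unifier; hence these sealed copies.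
infix  4 _⊑_ _⊏_ _≋_
infixl 6 _⊕_

opaque
  _⊑_ _⊏_ : ℝ → ℝ → Set
  _⊑_ = _≤_
  _⊏_ = _<_

  _⊕_ : ℝ → ℝ → ℝ
  _⊕_ = _+_

_≋_ : ℝ → ℝ → Set
x ≋ y = x ⊑ y × y ⊑ x

opaque
  unfolding _⊑_

  ≤⇒⊑ : ∀ {x y} → x ≤ y → x ⊑ y
  ≤⇒⊑ x≤y = x≤y

  ⊑⇒≤ : ∀ {x y} → x ⊑ y → x ≤ y
  ⊑⇒≤ x⊑y = x⊑y

  <⇒⊏ : ∀ {x y} → x < y → x ⊏ y
  <⇒⊏ x<y = x<y

  ⊏⇒< : ∀ {x y} → x ⊏ y → x < y
  ⊏⇒< x⊏y = x⊏y

  ⊕≡+ : ∀ x y → x ⊕ y ≡ x + y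
  ⊕≡+ x y = refl

  pointwise-⊑ : ∀ {x y} → (∀ n → seq x n ℚ.≤ seq y n) → x ⊑ y
  pointwise-⊑ {x} {y} x≤y ε 0<ε = 0 , λ n _ → ℚ.≤-trans (x≤y n) (p≤p+q (seq y n) 0<ε)

  ⊑-refl : ∀ {x} → x ⊑ x
  ⊑-refl {x} = pointwise-⊑ {x} {x} (λ n → ℚ.≤-refl)

  ≃-refl : ∀ x → x ≃ x
  ≃-refl x = ⊑-refl {x} , ⊑-refl {x}

  ⊑-trans : ∀ {x y z} → x ⊑ y → y ⊑ z → x ⊑ z
  ⊑-trans {x} {y} {z} x⊑y y⊑z ε 0<ε =
    eventually₂ (λ n p q → subst (seq x n ℚ.≤_) (+-halves (seq z n) ε)
                  (ℚ.≤-trans p (ℚ.+-monoˡ-≤ (ε ℚ.* ½) q)))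
      (x⊑y (ε ℚ.* ½) (half-pos 0<ε)) (y⊑z (ε ℚ.* ½) (half-pos 0<ε))

  ⊕-mono-⊑ : ∀ {x y u v} → x ⊑ y → u ⊑ v → x ⊕ u ⊑ y ⊕ v
  ⊕-mono-⊑ {x} {y} {u} {v} x⊑y u⊑v ε 0<ε =
    eventually₂ (λ n p q → subst (seq x n ℚ.+ seq u n ℚ.≤_) (lemma (seq y n) (seq v n) ε)
                  (ℚ.+-mono-≤ p q))
      (x⊑y (ε ℚ.* ½) (half-pos 0<ε)) (u⊑v (ε ℚ.* ½) (half-pos 0<ε))
    where lemma : ∀ y v ε → (y ℚ.+ ε ℚ.* ½) ℚ.+ (v ℚ.+ ε ℚ.* ½) ≡ y ℚ.+ v ℚ.+ ε
          lemma = solve 3 (λ y v ε → (y :+ ε :* con ½) :+ (v :+ ε :* con ½) := y :+ v :+ ε) refl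

  ⊕-cancelʳ-⊑ : ∀ {x y} z → x ⊕ z ⊑ y ⊕ z → x ⊑ y
  ⊕-cancelʳ-⊑ {x} {y} z le ε 0<ε with le ε 0<ε
  ... | N , p = N , λ n N≤n → +-cancelʳ-≤ (seq z n)
        (subst (seq x n ℚ.+ seq z n ℚ.≤_) (lemma (seq y n) (seq z n) ε) (p n N≤n))
    where lemma : ∀ y z ε → y ℚ.+ z ℚ.+ ε ≡ y ℚ.+ ε ℚ.+ z
          lemma = solve 3 (λ y z ε → y :+ z :+ ε := y :+ ε :+ z) refl

  pointwise-≋ : ∀ {x y} → (∀ n → seq x n ≡ seq y n) → x ≋ y
  pointwise-≋ {x} {y} x≡y = pointwise-⊑ {x} {y} (λ n → ℚ.≤-reflexive (x≡y n)) ,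
                            pointwise-⊑ {y} {x} (λ n → ℚ.≤-reflexive (sym (x≡y n)))

  ⊕-assoc : ∀ x y z → x ⊕ y ⊕ z ≋ x ⊕ (y ⊕ z)
  ⊕-assoc x y z = pointwise-≋ {x + y + z} {x + (y + z)} λ n → ℚ.+-assoc (seq x n) (seq y n) (seq z n)

  ⊕-comm : ∀ x y → x ⊕ y ≋ y ⊕ x
  ⊕-comm x y = pointwise-≋ {x + y} {y + x} λ n → ℚ.+-comm (seq x n) (seq y n)

  ⊕-identityʳ : ∀ x → x ⊕ 0ℝ ≋ x
  ⊕-identityʳ x = pointwise-≋ {x + 0ℝ} {x} λ n → ℚ.+-identityʳ (seq x n)

  ⊕-inverseʳ : ∀ x → x ⊕ (- x) ≋ 0ℝ
  ⊕-inverseʳ x = pointwise-≋ {x - x} {0ℝ} λ n → ℚ.+-inverseʳ (seq x n)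

  fromℚ-mono : ∀ {p q} → p ℚ.≤ q → fromℚ p ⊑ fromℚ q
  fromℚ-mono {p} {q} p≤q = pointwise-⊑ {fromℚ p} {fromℚ q} (λ _ → p≤q)

  fromℚ-+ : ∀ p q → fromℚ p ⊕ fromℚ q ≋ fromℚ (p ℚ.+ q)
  fromℚ-+ p q = pointwise-≋ {fromℚ p + fromℚ q} {fromℚ (p ℚ.+ q)} λ _ → refl

  -- With `gap⇒⊏` this reduces the strict order to `⊑` and a positive rational gap, so that most
  -- strict estimates need no sequences.
  ⊏⇒gap : ∀ {x y} → x ⊏ y → ∃ λ e → 0ℚ ℚ.< e × x ⊕ fromℚ e ⊑ y
  ⊏⇒gap {x} {y} (e , 0<e , N , p) = e , 0<e , λ ε 0<ε → N , λ n N≤n →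
    ℚ.≤-trans (p n N≤n) (p≤p+q (seq y n) 0<ε)

  -- `⊑` holds only up to arbitrarily small errors, so half of the gap is spent on the error and the
  -- other half survives.
  gap⇒⊏ : ∀ {x y e} → 0ℚ ℚ.< e → x ⊕ fromℚ e ⊑ y → x ⊏ y
  gap⇒⊏ {x} {y} {e} 0<e le with le (e ℚ.* ½) (half-pos 0<e)
  ... | N , p = e ℚ.* ½ , half-pos 0<e , N , λ n N≤n → +-cancelʳ-≤ (e ℚ.* ½)
        (subst (ℚ._≤ seq y n ℚ.+ e ℚ.* ½) (sym (+-halves (seq x n) e)) (p n N≤n))

  ⊏⇒⋣ : ∀ {x y} → x ⊏ y → y ⊑ x → ⊥
  ⊏⇒⋣ {x} {y} (e , 0<e , x<y) y⊑x with eventually₂ (λ n p q → ℚ.≤-trans p q) x<y (y⊑x (e ℚ.* ½) (half-pos 0<e))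
  ... | N , p = ℚ.<-irrefl refl (ℚ.<-≤-trans e/2<e (cancel-x (p N ℕ.≤-refl)))
    where
    cancel-x : seq x N ℚ.+ e ℚ.≤ seq x N ℚ.+ e ℚ.* ½ → e ℚ.≤ e ℚ.* ½
    cancel-x le = +-cancelʳ-≤ (seq x N) (subst₂ ℚ._≤_ (ℚ.+-comm (seq x N) e) (ℚ.+-comm (seq x N) (e ℚ.* ½)) le)
    e/2<e : e ℚ.* ½ ℚ.< e
    e/2<e = subst₂ ℚ._<_ (ℚ.+-identityʳ (e ℚ.* ½)) (ε/2+ε/2≡ε e) (ℚ.+-monoʳ-< (e ℚ.* ½) (half-pos 0<e))

  ⊑-limit : ∀ {x y} → (∀ e → 0ℚ ℚ.< e → x ⊑ y ⊕ fromℚ e) → x ⊑ y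
  ⊑-limit {x} {y} le ε 0<ε with le (ε ℚ.* ½) (half-pos 0<ε) (ε ℚ.* ½) (half-pos 0<ε)
  ... | N , p = N , λ n N≤n → subst (seq x n ℚ.≤_) (+-halves (seq y n) ε) (p n N≤n)

  ⊏̸⇒⊒ : ∀ {x y} → (x ⊏ y → ⊥) → y ⊑ x
  ⊏̸⇒⊒ {x} {y} = ≮⇒≥ x y

  x⊓y⊑x : ∀ x y → x ⊓ y ⊑ x
  x⊓y⊑x x y = pointwise-⊑ {x ⊓ y} {x} λ n → ℚ.p⊓q≤p (seq x n) (seq y n)

  x⊓y⊑y : ∀ x y → x ⊓ y ⊑ y
  x⊓y⊑y x y = pointwise-⊑ {x ⊓ y} {y} λ n → ℚ.p⊓q≤q (seq x n) (seq y n)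

  ⊓-glb : ∀ {x y z} → z ⊑ x → z ⊑ y → z ⊑ x ⊓ y
  ⊓-glb {x} {y} {z} z⊑x z⊑y ε 0<ε = eventually₂
    (λ n p q → subst (seq z n ℚ.≤_) (sym (ℚ.mono-≤-distrib-⊓ (ℚ.+-monoˡ-≤ ε) (seq x n) (seq y n)))
       (ℚ.⊓-glb p q))
    (z⊑x ε 0<ε) (z⊑y ε 0<ε)

  x⊑x⊔y : ∀ x y → x ⊑ x ⊔ y
  x⊑x⊔y x y = pointwise-⊑ {x} {x ⊔ y} λ n → ℚ.p≤p⊔q (seq x n) (seq y n)

  y⊑x⊔y : ∀ x y → y ⊑ x ⊔ y
  y⊑x⊔y x y = pointwise-⊑ {y} {x ⊔ y} λ n → ℚ.p≤q⊔p (seq x n) (seq y n)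

  ⊔-lub : ∀ {x y z} → x ⊑ z → y ⊑ z → x ⊔ y ⊑ z
  ⊔-lub {x} {y} {z} x⊑z y⊑z ε 0<ε = eventually₂ (λ n p q → ℚ.⊔-lub p q) (x⊑z ε 0<ε) (y⊑z ε 0<ε)

⊑-poset : Poset 0ℓ 0ℓ 0ℓ
⊑-poset = record
  { _≈_ = _≋_ ; _≤_ = _⊑_
  ; isPartialOrder = record
    { isPreorder = record
      { isEquivalence = record
        { refl  = ⊑-refl , ⊑-refl
        ; sym   = swap
        ; trans = λ (p , p′) (q , q′) → ⊑-trans p q , ⊑-trans q′ p′
        }
      ; reflexive = proj₁
      ; trans     = ⊑-trans
      }
    ; antisym = _,_
    }
  }

open import Relation.Binary.Reasoning.PartialOrder ⊑-poset
  using (begin_; _∎; step-≤; step-≈-⟩)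

⊕-0-commutativeMonoid : CommutativeMonoid 0ℓ 0ℓ
⊕-0-commutativeMonoid = record
  { _≈_ = _≋_ ; _∙_ = _⊕_ ; ε = 0ℝ
  ; isCommutativeMonoid = record
    { isMonoid = record
      { isSemigroup = record
        { isMagma = record
          { isEquivalence = Poset.isEquivalence ⊑-poset
          ; ∙-cong = λ (p , p′) (q , q′) → ⊕-mono-⊑ p q , ⊕-mono-⊑ p′ q′
          }
        ; assoc = ⊕-assoc
        }
      ; identity = (λ x → Poset.Eq.trans ⊑-poset (⊕-comm 0ℝ x) (⊕-identityʳ x)) , ⊕-identityʳ
      }
    ; comm = ⊕-comm
    }
  }

open CommutativeMonoid ⊕-0-commutativeMonoid using ()
  renaming (refl to ≋-refl; sym to ≋-sym; trans to ≋-trans; ∙-cong to ⊕-cong; identityˡ to ⊕-identityˡ)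

module ⊕-Solver = CommutativeMonoidSolver ⊕-0-commutativeMonoid
open ⊕-Solver using (_⊜_) renaming (_⊕_ to _⊕′_)

⊕-monoˡ : ∀ {x y} z → x ⊑ y → x ⊕ z ⊑ y ⊕ z
⊕-monoˡ z x⊑y = ⊕-mono-⊑ x⊑y ⊑-refl

⊕-monoʳ : ∀ {x y} z → x ⊑ y → z ⊕ x ⊑ z ⊕ y
⊕-monoʳ z x⊑y = ⊕-mono-⊑ ⊑-refl x⊑y

fromℚ-nonNeg : ∀ {q} → 0ℚ ℚ.< q → 0ℝ ⊑ fromℚ q
fromℚ-nonNeg 0<q = fromℚ-mono (ℚ.<⇒≤ 0<q)

x⊑x⊕y : ∀ {y} x → 0ℝ ⊑ y → x ⊑ x ⊕ y
x⊑x⊕y x 0⊑y = ⊑-trans (proj₂ (⊕-identityʳ x)) (⊕-monoʳ x 0⊑y)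

⊕-nonNeg : ∀ {x y} → 0ℝ ⊑ x → 0ℝ ⊑ y → 0ℝ ⊑ x ⊕ y
⊕-nonNeg {x} 0⊑x 0⊑y = ⊑-trans 0⊑x (x⊑x⊕y x 0⊑y)

⊏⇒⊑ : ∀ {x y} → x ⊏ y → x ⊑ y
⊏⇒⊑ {x} x⊏y = let _ , 0<e , gap = ⊏⇒gap x⊏y in ⊑-trans (x⊑x⊕y x (fromℚ-nonNeg 0<e)) gap

⊏-⊑-trans : ∀ {x y z} → x ⊏ y → y ⊑ z → x ⊏ z
⊏-⊑-trans x⊏y y⊑z = let _ , 0<e , gap = ⊏⇒gap x⊏y in gap⇒⊏ 0<e (⊑-trans gap y⊑z)

⊑-⊏-trans : ∀ {x y z} → x ⊑ y → y ⊏ z → x ⊏ z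
⊑-⊏-trans x⊑y y⊏z = let e , 0<e , gap = ⊏⇒gap y⊏z in
  gap⇒⊏ 0<e (⊑-trans (⊕-monoˡ (fromℚ e) x⊑y) gap)

fromℚ-pos : ∀ {q} → 0ℚ ℚ.< q → 0ℝ ⊏ fromℚ q
fromℚ-pos {q} 0<q = gap⇒⊏ {0ℝ} {fromℚ q} {q} 0<q (proj₁ (⊕-identityˡ (fromℚ q)))

x⊏x⊕e : ∀ x {e} → 0ℚ ℚ.< e → x ⊏ x ⊕ fromℚ e
x⊏x⊕e x 0<e = gap⇒⊏ 0<e ⊑-refl

⊕-cancelʳ-⊏ : ∀ {x y} z → x ⊕ z ⊏ y ⊕ z → x ⊏ y
⊕-cancelʳ-⊏ {x} {y} z lt = let e , 0<e , gap = ⊏⇒gap lt in gap⇒⊏ 0<e (⊕-cancelʳ-⊑ z (begin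
  x ⊕ fromℚ e ⊕ z  ≈⟨ ⊕-Solver.solve 3 (λ x e z → (x ⊕′ e) ⊕′ z ⊜ (x ⊕′ z) ⊕′ e) ≋-refl x (fromℚ e) z ⟩
  x ⊕ z ⊕ fromℚ e  ≤⟨ gap ⟩
  y ⊕ z            ∎))

x-y+y≋x : ∀ x y → x ⊕ (- y) ⊕ y ≋ x
x-y+y≋x x y = ≋-trans (⊕-assoc x (- y) y)
  (≋-trans (⊕-cong ≋-refl (≋-trans (⊕-comm (- y) y) (⊕-inverseʳ y))) (⊕-identityʳ x))

x⊑y⊕z⇒x-y⊑z : ∀ {x y z} → x ⊑ y ⊕ z → x ⊕ (- y) ⊑ z
x⊑y⊕z⇒x-y⊑z {x} {y} {z} le = ⊕-cancelʳ-⊑ y (begin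
  x ⊕ (- y) ⊕ y  ≈⟨ x-y+y≋x x y ⟩
  x              ≤⟨ le ⟩
  y ⊕ z          ≈⟨ ⊕-comm y z ⟩
  z ⊕ y          ∎)

difference : ∀ {x y} → x ⊑ y → ∃ λ z → 0ℝ ⊑ z × x ⊕ z ≋ y
difference {x} {y} x⊑y = y ⊕ (- x) , 0⊑y-x , x+y-x≋y
  where
  0⊑y-x : 0ℝ ⊑ y ⊕ (- x)
  0⊑y-x = ⊑-trans (proj₂ (⊕-inverseʳ x)) (⊕-monoˡ (- x) x⊑y)
  x+y-x≋y : x ⊕ (y ⊕ (- x)) ≋ y
  x+y-x≋y = ≋-trans (⊕-Solver.solve 3 (λ x y z → x ⊕′ (y ⊕′ z) ⊜ y ⊕′ (x ⊕′ z)) ≋-refl x y (- x))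
    (≋-trans (⊕-cong ≋-refl (⊕-inverseʳ x)) (⊕-identityʳ y))

opaque
  unfolding _⊑_

  -[x-y]⊑y-x : ∀ x y → - (x - y) ⊑ y ⊕ (- x)
  -[x-y]⊑y-x x y = pointwise-⊑ { - (x - y)} {y - x} λ n → ℚ.≤-reflexive (lemma (seq x n) (seq y n))
    where lemma : ∀ p q → ℚ.- (p ℚ.+ ℚ.- q) ≡ q ℚ.+ ℚ.- p
          lemma = solve 2 (λ p q → :- (p :+ :- q) := q :+ :- p) refl

  rational-above : ∀ x → ∃ λ q → x ⊑ fromℚ q
  rational-above x with cauchy x 1ℚ (ℚ.positive⁻¹ 1ℚ)
  ... | N , p = seq x N ℚ.+ 1ℚ , λ ε 0<ε → N , λ n N≤n →
        ℚ.≤-trans (p n N N≤n ℕ.≤-refl) (p≤p+q (seq x N ℚ.+ 1ℚ) 0<ε)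

  rational-below : ∀ x → ∃ λ q → fromℚ q ⊑ x
  rational-below x with cauchy x 1ℚ (ℚ.positive⁻¹ 1ℚ)
  ... | N , p = seq x N ℚ.+ ℚ.- 1ℚ , λ ε 0<ε → N , λ n N≤n →
        ℚ.≤-trans (subst (seq x N ℚ.+ ℚ.- 1ℚ ℚ.≤_) (lemma (seq x n))
          (ℚ.+-monoˡ-≤ (ℚ.- 1ℚ) (p N n ℕ.≤-refl N≤n))) (p≤p+q (seq x n) 0<ε)
    where lemma : ∀ p → p ℚ.+ 1ℚ ℚ.+ ℚ.- 1ℚ ≡ p
          lemma = solve 1 (λ p → p :+ con 1ℚ :+ :- con 1ℚ := p) refl

distance-< : ∀ {x y δ} e → x ⊑ y ⊕ fromℚ e → y ⊑ x ⊕ fromℚ e → fromℚ e ⊏ δ → ∣ x - y ∣ < δ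
distance-< {x} {y} e x⊑y+e y⊑x+e e⊏δ = ⊏⇒< (⊑-⊏-trans (⊔-lub
  (subst (_⊑ fromℚ e) (⊕≡+ x (- y)) (x⊑y⊕z⇒x-y⊑z x⊑y+e))
  (⊑-trans (-[x-y]⊑y-x x y) (x⊑y⊕z⇒x-y⊑z y⊑x+e))) e⊏δ)

module Classical {a : Level} (em : ExcludedMiddle a) where

  -- Excluded middle is given at level `a`, whereas comparisons of reals live in `Set`.
  decide : (P : Set) → Dec P
  decide P = map′ lower lift (em {Lift a P})

  ⊑-or-⊐ : ∀ x y → x ⊑ y ⊎ y ⊏ x
  ⊑-or-⊐ x y with decide (y ⊏ x)
  ... | yes y⊏x = inj₂ y⊏x
  ... | no  y⊏̸x = inj₁ (⊏̸⇒⊒ y⊏̸x)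

-- Archimedean property and rational approximation

infixr 7 _·_

_·_ : ℕ → ℚ → ℚ
zero  · q = 0ℚ
suc k · q = q ℚ.+ k · q

·-* : ∀ k p q → (k · p) ℚ.* q ≡ k · (p ℚ.* q)
·-* zero    p q = ℚ.*-zeroˡ q
·-* (suc k) p q = trans (ℚ.*-distribʳ-+ q p (k · p)) (cong (p ℚ.* q ℚ.+_) (·-* k p q))

fromℕ : ℕ → ℚ
fromℕ k = mkℚ (+ k) 0 (Coprimality.sym (Coprimality.1-coprimeTo k))

·1≡fromℕ : ∀ k → k · 1ℚ ≡ fromℕ k
·1≡fromℕ zero    = refl
·1≡fromℕ (suc k) = trans (cong (1ℚ ℚ.+_) (·1≡fromℕ k)) (ℚ.toℚᵘ-injective
  (ℚᵘ.≃-trans (ℚ.toℚᵘ-homo-+ 1ℚ (fromℕ k)) (ℚᵘ.*≡* (cong (λ i → (+ 1 ℤ.+ i) ℤ.* + 1) (ℤ.*-identityʳ (+ k))))))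

archimedean-1 : ∀ p → ∃ λ k → p ℚ.≤ k · 1ℚ
archimedean-1 p@(mkℚ i d _) = ℤ.∣ i ∣ , subst (p ℚ.≤_) (sym (·1≡fromℕ ℤ.∣ i ∣)) (ℚ.*≤*
  (ℤ.≤-trans (ℤ.*-monoʳ-≤-nonNeg (+ 1) (i≤∣i∣ i))
             (ℤ.*-monoˡ-≤-nonNeg (+ ℤ.∣ i ∣) (ℤ.+≤+ (ℕ.s≤s (ℕ.z≤n {d}))))))
  where
  i≤∣i∣ : ∀ i → i ℤ.≤ + ℤ.∣ i ∣
  i≤∣i∣ (+ _)    = ℤ.≤-refl
  i≤∣i∣ -[1+ _ ] = ℤ.-≤+

archimedean : ∀ p {e} → 0ℚ ℚ.< e → ∃ λ k → p ℚ.≤ k · e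
archimedean p {e} 0<e = k , subst₂ ℚ._≤_ p/e*e≡p k·1*e≡k·e (ℚ.*-monoʳ-≤-nonNeg e p/e≤k)
  where
  instance
    e-pos = ℚ.positive 0<e
    e-nonNeg = ℚ.pos⇒nonNeg e
    e-nonZero = ℚ.pos⇒nonZero e
  k = proj₁ (archimedean-1 (p ℚ.* ℚ.1/ e))
  p/e≤k = proj₂ (archimedean-1 (p ℚ.* ℚ.1/ e))
  p/e*e≡p : p ℚ.* ℚ.1/ e ℚ.* e ≡ p
  p/e*e≡p = trans (ℚ.*-assoc p (ℚ.1/ e) e) (trans (cong (p ℚ.*_) (ℚ.*-inverseˡ e)) (ℚ.*-identityʳ p))
  k·1*e≡k·e : (k · 1ℚ) ℚ.* e ≡ k · e
  k·1*e≡k·e = trans (·-* k 1ℚ e) (cong (k ·_) (ℚ.*-identityˡ e))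

1/[1+_] : ℕ → ℚ
1/[1+ n ] = mkℚ (+ 1) n (Coprimality.1-coprimeTo (suc n))

1/[1+n]-pos : ∀ n → 0ℚ ℚ.< 1/[1+ n ]
1/[1+n]-pos n = ℚ.positive⁻¹ 1/[1+ n ]

1/[1+n]→0 : ∀ {ε} → 0ℚ ℚ.< ε → Eventually (λ n → 1/[1+ n ] ℚ.≤ ε)
1/[1+n]→0 {mkℚ (+ suc m) d _} _ = d , λ n d≤n → ℚ.*≤* (ℤ.≤-trans
  (ℤ.≤-reflexive (ℤ.*-identityˡ (+ suc d)))
  (ℤ.≤-trans (ℤ.+≤+ (ℕ.s≤s d≤n))
  (ℤ.≤-trans (ℤ.≤-reflexive (sym (ℤ.*-identityˡ (+ suc n))))
             (ℤ.*-monoʳ-≤-nonNeg (+ suc n) (ℤ.+≤+ (ℕ.s≤s (ℕ.z≤n {m})))))))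
1/[1+n]→0 {mkℚ (+ zero) d _} (ℚ.*<* (ℤ.+<+ ()))
1/[1+n]→0 {mkℚ -[1+ _ ] d _} (ℚ.*<* ())

opaque
  unfolding _⊑_

  seq-near : ∀ x {e} → 0ℚ ℚ.< e →
    Eventually (λ n → x ⊑ fromℚ (seq x n) ⊕ fromℚ e × fromℚ (seq x n) ⊑ x ⊕ fromℚ e)
  seq-near x {e} 0<e with cauchy x e 0<e
  ... | N , p = N , λ n N≤n →
    (λ ε 0<ε → N , λ m N≤m → ℚ.≤-trans (p m n N≤m N≤n) (p≤p+q (seq x n ℚ.+ e) 0<ε)) ,
    (λ ε 0<ε → N , λ m N≤m → ℚ.≤-trans (p n m N≤n N≤m) (p≤p+q (seq x m ℚ.+ e) 0<ε))

fromℚ-+-≡ : ∀ {p q e} → p ℚ.+ e ≡ q → fromℚ p ⊕ fromℚ e ≋ fromℚ q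
fromℚ-+-≡ {p} {e = e} refl = fromℚ-+ p e

fromℚ-cancel : ∀ {p q} → fromℚ p ⊑ fromℚ q → p ℚ.≤ q
fromℚ-cancel {p} {q} p⊑q with p ℚ.≤? q
... | yes p≤q = p≤q
... | no  p≰q = contradiction p⊑q (⊏⇒⋣ (gap⇒⊏ 0<p-q (proj₁ (fromℚ-+-≡ q+p-q≡p))))
  where
  0<p-q : 0ℚ ℚ.< p ℚ.- q
  0<p-q = subst (ℚ._< p ℚ.- q) (ℚ.+-inverseʳ q) (ℚ.+-monoˡ-< (ℚ.- q) (ℚ.≰⇒> p≰q))
  q+p-q≡p : q ℚ.+ (p ℚ.- q) ≡ p
  q+p-q≡p = solve 2 (λ p q → q :+ (p :+ :- q) := p) refl p q

⊑-seq : ∀ {x y} → (∀ n → x ⊑ fromℚ (seq y n)) → x ⊑ y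
⊑-seq {x} {y} x⊑yₙ = ⊑-limit λ e 0<e → let N , near = seq-near y 0<e in
  ⊑-trans (x⊑yₙ N) (proj₂ (near N ℕ.≤-refl))

seq-⊑ : ∀ {x y} → (∀ n → fromℚ (seq x n) ⊑ y ⊕ fromℚ 1/[1+ n ]) → x ⊑ y
seq-⊑ {x} {y} xₙ⊑y+1/n = ⊑-limit λ e 0<e →
  let N , near = eventually₂ (λ n p q → p , q) (seq-near x (half-pos 0<e)) (1/[1+n]→0 (half-pos 0<e))
      (x⊑ , _) , 1/N≤ = near N ℕ.≤-refl
      h = fromℚ (e ℚ.* ½)
  in begin
    x                           ≤⟨ x⊑ ⟩
    fromℚ (seq x N) ⊕ h         ≤⟨ ⊕-monoˡ h (xₙ⊑y+1/n N) ⟩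
    y ⊕ fromℚ 1/[1+ N ] ⊕ h     ≤⟨ ⊕-monoˡ h (⊕-monoʳ y (fromℚ-mono 1/N≤)) ⟩
    y ⊕ h ⊕ h                   ≈⟨ ⊕-assoc y h h ⟩
    y ⊕ (h ⊕ h)                 ≈⟨ ⊕-cong (≋-refl {y}) (fromℚ-+-≡ (ε/2+ε/2≡ε e)) ⟩
    y ⊕ fromℚ e                 ∎

x⊕y⊑z⇒x⊑z-y : ∀ {x y z} → x ⊕ y ⊑ z → x ⊑ z ⊕ (- y)
x⊕y⊑z⇒x⊑z-y {x} {y} {z} le = ⊕-cancelʳ-⊑ y (⊑-trans le (proj₂ (x-y+y≋x z y)))

-- Suprema and infima

module Completeness {a : Level} (em : ExcludedMiddle a) where

  open Classical em

  module _ (S : Pred ℝ a) where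

    private
      -- Descend from an upper bound in steps of e until the next step fails to be one.
      search : ∀ k {e lo hi} → (∀ b → IsUpperBound S b → fromℚ lo ⊑ b) → 0ℚ ℚ.< e →
        hi ℚ.≤ lo ℚ.+ k · e → IsUpperBound S (fromℚ hi) →
        ∃ λ q → IsUpperBound S (fromℚ q) × (∀ b → IsUpperBound S b → fromℚ q ⊑ b ⊕ fromℚ e)
      search zero {e} {lo} {hi} lo⊑ 0<e hi≤ ub = hi , ub , λ b ub-b →
        ⊑-trans (fromℚ-mono (subst (hi ℚ.≤_) (ℚ.+-identityʳ lo) hi≤))
        (⊑-trans (lo⊑ b ub-b) (x⊑x⊕y b (fromℚ-nonNeg 0<e)))
      search (suc k) {e} {lo} {hi} lo⊑ 0<e hi≤ ub with em {IsUpperBound S (fromℚ (hi ℚ.- e))}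
      ... | yes ub′ = search k lo⊑ 0<e
            (subst (hi ℚ.- e ℚ.≤_) (lemma lo e (k · e)) (ℚ.+-monoˡ-≤ (ℚ.- e) hi≤)) ub′
        where
        lemma : ∀ p q r → p ℚ.+ (q ℚ.+ r) ℚ.- q ≡ p ℚ.+ r
        lemma = solve 3 (λ p q r → p :+ (q :+ r) :+ :- q := p :+ r) refl
      ... | no ¬ub′ = hi , ub , within
        where
        hi-e+e≡hi : ∀ p q → p ℚ.- q ℚ.+ q ≡ p
        hi-e+e≡hi = solve 2 (λ p q → p :+ :- q :+ q := p) refl
        within : ∀ b → IsUpperBound S b → fromℚ hi ⊑ b ⊕ fromℚ e
        within b ub-b with ⊑-or-⊐ (fromℚ (hi ℚ.- e)) b
        ... | inj₁ le = ⊑-trans (proj₂ (fromℚ-+-≡ (hi-e+e≡hi hi e))) (⊕-monoˡ (fromℚ e) le)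
        ... | inj₂ gt = contradiction
              (λ x x∈S → ⊑⇒≤ {x} (⊑-trans (≤⇒⊑ {x} {b} (ub-b x x∈S)) (⊏⇒⊑ gt))) ¬ub′

    -- A rational below some member of `S` is below every upper bound; the Archimedean property
    -- turns it into a bound on the number of steps of the descent.
    grid-sup : ∀ b → ∃ S → IsUpperBound S b → ∀ {e} → 0ℚ ℚ.< e →
      ∃ λ q → IsUpperBound S (fromℚ q) × (∀ b → IsUpperBound S b → fromℚ q ⊑ b ⊕ fromℚ e)
    grid-sup b (x , x∈S) ub {e} 0<e with rational-below x | rational-above b
    ... | lo , lo⊑x | hi , b⊑hi with archimedean (hi ℚ.- lo) 0<e
    ... | k , le = search k (λ b ub-b → ⊑-trans lo⊑x (≤⇒⊑ {x} {b} (ub-b x x∈S))) 0<e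
          (subst (ℚ._≤ lo ℚ.+ k · e) (lemma lo hi) (ℚ.+-monoʳ-≤ lo le))
          (λ y y∈S → ⊑⇒≤ {y} (⊑-trans (≤⇒⊑ {y} {b} (ub y y∈S)) b⊑hi))
      where
      lemma : ∀ p q → p ℚ.+ (q ℚ.- p) ≡ q
      lemma = solve 2 (λ p q → p :+ (q :+ :- p) := q) refl

    -- The sequence of approximations is itself the supremum: each `q n` is an upper bound that
    -- exceeds any other upper bound, in particular any other `q m`, by at most `1/[1+ n ]`, which
    -- makes the sequence Cauchy.
    sup-exists : ∀ b → ∃ S → IsUpperBound S b → ∃ (IsSup S)
    sup-exists b₀ inhabited ub = s ,
      (λ x x∈S → ⊑⇒≤ {x} {s} (⊑-seq {y = s} λ n → ≤⇒⊑ {x} {fromℚ (q n)} (q-ub n x x∈S))) ,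
      (λ b ub-b → ⊑⇒≤ {s} {b} (seq-⊑ {s} λ n → q-least n b ub-b))
      where
      approx : ∀ n → ∃ λ q → IsUpperBound S (fromℚ q) ×
        (∀ b → IsUpperBound S b → fromℚ q ⊑ b ⊕ fromℚ 1/[1+ n ])
      approx n = grid-sup b₀ inhabited ub (1/[1+n]-pos n)
      q : ℕ → ℚ
      q n = proj₁ (approx n)
      q-ub : ∀ n → IsUpperBound S (fromℚ (q n))
      q-ub n = proj₁ (proj₂ (approx n))
      q-least : ∀ n b → IsUpperBound S b → fromℚ (q n) ⊑ b ⊕ fromℚ 1/[1+ n ]
      q-least n = proj₂ (proj₂ (approx n))
      q-near : ∀ m n → q m ℚ.≤ q n ℚ.+ 1/[1+ m ]
      q-near m n = fromℚ-cancel (⊑-trans (q-least m (fromℚ (q n)) (q-ub n)) (proj₁ (fromℚ-+ (q n) 1/[1+ m ])))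
      s : ℝ
      s = mkℝ q λ ε 0<ε → let N , small = 1/[1+n]→0 0<ε in N , λ m n N≤m N≤n →
        ℚ.≤-trans (q-near m n) (ℚ.+-monoʳ-≤ (q n) (small m N≤m))

    sup-approx : ∀ {s} → IsSup S s → ∀ {e} → 0ℚ ℚ.< e → ∃ λ x → S x × s ⊑ x ⊕ fromℚ e
    sup-approx {s} (_ , least) {e} 0<e with em {∃ λ x → S x × s ⊑ x ⊕ fromℚ e}
    ... | yes found = found
    ... | no  none  = contradiction
          (≤⇒⊑ {s} {s ⊕ (- fromℚ e)} (least (s ⊕ (- fromℚ e)) s-e-ub))
          (⊏⇒⋣ (gap⇒⊏ {e = e} 0<e (proj₁ (x-y+y≋x s (fromℚ e)))))
      where
      s-e-ub : IsUpperBound S (s ⊕ (- fromℚ e))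
      s-e-ub x x∈S with ⊑-or-⊐ s (x ⊕ fromℚ e)
      ... | inj₁ le = contradiction (x , x∈S , le) none
      ... | inj₂ gt = ⊑⇒≤ {x} (x⊕y⊑z⇒x⊑z-y (⊏⇒⊑ gt))

    inf-approx : ∀ {s} → IsInf S s → ∀ {e} → 0ℚ ℚ.< e → ∃ λ x → S x × x ⊑ s ⊕ fromℚ e
    inf-approx {s} (_ , greatest) {e} 0<e with em {∃ λ x → S x × x ⊑ s ⊕ fromℚ e}
    ... | yes found = found
    ... | no  none  = contradiction (≤⇒⊑ {s ⊕ fromℚ e} {s} (greatest (s ⊕ fromℚ e) s+e-lb)) (⊏⇒⋣ (x⊏x⊕e s 0<e))
      where
      s+e-lb : IsLowerBound S (s ⊕ fromℚ e)
      s+e-lb x x∈S with ⊑-or-⊐ x (s ⊕ fromℚ e)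
      ... | inj₁ le = contradiction (x , x∈S , le) none
      ... | inj₂ gt = ⊑⇒≤ {s ⊕ fromℚ e} {x} (⊏⇒⊑ gt)

  -- The infimum is obtained as the supremum of the lower bounds.
  inf-exists : (S : Pred ℝ a) → ∀ b → ∃ S → IsLowerBound S b → ∃ (IsInf S)
  inf-exists S b (x , x∈S) lb = s , (λ y y∈S → least y λ c lb-c → lb-c y y∈S) , ub
    where
    sup-lb : ∃ (IsSup (IsLowerBound S))
    sup-lb = sup-exists (IsLowerBound S) x (b , lb) (λ c lb-c → lb-c x x∈S)
    s : ℝ
    s = proj₁ sup-lb
    ub : IsUpperBound (IsLowerBound S) s
    ub = proj₁ (proj₂ sup-lb)
    least : ∀ c → IsUpperBound (IsLowerBound S) c → s ≤ c
    least = proj₂ (proj₂ sup-lb)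

opaque
  unfolding _⊑_

  neg-swap : ∀ {x y z} → x ⊑ y ⊕ z → - y ⊑ (- x) ⊕ z
  neg-swap {x} {y} {z} le ε 0<ε with le ε 0<ε
  ... | N , p = N , λ n N≤n → subst₂ ℚ._≤_ (lemma₁ (seq x n) (seq y n)) (lemma₂ (seq x n) (seq y n) (seq z n) ε)
          (ℚ.+-monoˡ-≤ (ℚ.- seq x n ℚ.+ ℚ.- seq y n) (p n N≤n))
    where
    lemma₁ : ∀ x y → x ℚ.+ (ℚ.- x ℚ.+ ℚ.- y) ≡ ℚ.- y
    lemma₁ = solve 2 (λ x y → x :+ (:- x :+ :- y) := :- y) refl
    lemma₂ : ∀ x y z ε → y ℚ.+ z ℚ.+ ε ℚ.+ (ℚ.- x ℚ.+ ℚ.- y) ≡ ℚ.- x ℚ.+ z ℚ.+ ε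
    lemma₂ = solve 4 (λ x y z ε → y :+ z :+ ε :+ (:- x :+ :- y) := :- x :+ z :+ ε) refl

neg-cancel-⊑ : ∀ {x y} → - x ⊑ - y → y ⊑ x
neg-cancel-⊑ {x} {y} -x⊑-y = ⊕-cancelʳ-⊑ (- x) (begin
  y ⊕ (- x)  ≤⟨ ⊕-monoʳ y -x⊑-y ⟩
  y ⊕ (- y)  ≈⟨ ⊕-inverseʳ y ⟩
  0ℝ         ≈⟨ ≋-sym (⊕-inverseʳ x) ⟩
  x ⊕ (- x)  ∎)

⊕-monoʳ-⊏ : ∀ {x y} z → x ⊏ y → z ⊕ x ⊏ z ⊕ y
⊕-monoʳ-⊏ {x} z x⊏y = let e , 0<e , gap = ⊏⇒gap x⊏y in
  gap⇒⊏ 0<e (⊑-trans (proj₁ (⊕-assoc z x (fromℚ e))) (⊕-monoʳ z gap))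

⊏-absorb : ∀ {x y e δ} → x ⊕ e ⊑ y ⊕ δ → δ ⊏ e → x ⊏ y
⊏-absorb {x} {δ = δ} le δ⊏e = ⊕-cancelʳ-⊏ δ (⊏-⊑-trans (⊕-monoʳ-⊏ x δ⊏e) le)

-- Compactness: attained extrema and uniform choices

module Metric {a ℓ : Level} (M : MetricSpace a ℓ) where
  open MetricSpace M renaming (Carrier to X) public
  open IsGeneralMetric isMetric using (nonNegative; triangle; ≈⇒0; module EqC) renaming (sym to ≈-sym)

  d-nonNeg : ∀ x y → 0ℝ ⊑ d x y
  d-nonNeg x y = ≤⇒⊑ {0ℝ} {d x y} nonNegative

  d-sym : ∀ x y → d x y ⊑ d y x
  d-sym x y = ≤⇒⊑ {d x y} {d y x} (proj₁ (≈-sym x y))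

  d-triangle : ∀ x y z → d x z ⊑ d x y ⊕ d y z
  d-triangle x y z = subst (d x z ⊑_) (sym (⊕≡+ (d x y) (d y z)))
    (≤⇒⊑ {d x z} {d x y + d y z} (triangle x y z))

  ≈⇒d⊑0 : ∀ {x y} → x ≈ y → d x y ⊑ 0ℝ
  ≈⇒d⊑0 {x} {y} x≈y = ≤⇒⊑ {d x y} {0ℝ} (proj₁ (≈⇒0 x≈y))

  d-refl : ∀ x → d x x ⊑ 0ℝ
  d-refl x = ≈⇒d⊑0 EqC.refl

module CompactSpace {a ℓ : Level} (em : ExcludedMiddle a)
                    (M : MetricSpace a ℓ) (compact : IsCompact M) where
  open Classical em
  open Metric M

  Lipschitz : (X → ℝ) → Set a
  Lipschitz f = ∀ x y → f x ⊑ f y ⊕ d x y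

  module _ (f : X → ℝ) where

    argmin : {P : X → Set} (i : ∃ P) (is : List (∃ P)) →
             ∃ λ (j : ∃ P) → All (λ k → f (proj₁ j) ⊑ f (proj₁ k)) is
    argmin i [] = i , []
    argmin i (k ∷ is) with argmin i is
    ... | j , j-min with ⊑-or-⊐ (f (proj₁ j)) (f (proj₁ k))
    ... | inj₁ j⊑k = j , j⊑k ∷ j-min
    ... | inj₂ k⊏j = k , ⊑-refl ∷ All.map (⊑-trans (⊏⇒⊑ k⊏j)) j-min

    IsMinOnBall : X → ℝ → X → Set a
    IsMinOnBall x t y = d x y ⊑ t × (∀ z → d x z ⊑ t → f y ⊑ f z)

    opaque
      -- If no point of the ball were minimal, the sets of points that are
      -- beaten by y, or lie outside the ball, would form an open cover; but the
      -- best among finitely many y is beaten by none of them.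
      min-on-ball : Lipschitz f → ∀ x t → 0ℝ ⊑ t → ∃ (IsMinOnBall x t)
      min-on-ball lip x t 0⊑t with em {∃ (IsMinOnBall x t)}
      ... | yes found = found
      ... | no  none  = contradiction (proj₂ cover best) λ beaten →
            absurd (Any.lookup beaten) (All.lookupAny (proj₂ best-min) beaten)
        where
        Ball : Set a
        Ball = ∃ λ y → d x y ⊑ t
        U : Ball → Pred X a
        U (y , _) z = Lift a (f y ⊏ f z ⊎ t ⊏ d x z)
        U-open : ∀ i → IsOpen M (U i)
        U-open (y , _) z (lift (inj₁ fy⊏fz)) with ⊏⇒gap fy⊏fz
        ... | e , 0<e , gap = fromℚ e , ⊏⇒< {0ℝ} {fromℚ e} (fromℚ-pos {e} 0<e) ,
              λ w dzw<e → lift (inj₁ (⊏-absorb (⊑-trans gap (lip z w)) (<⇒⊏ {d z w} {fromℚ e} dzw<e)))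
        U-open (y , _) z (lift (inj₂ t⊏dxz)) with ⊏⇒gap t⊏dxz
        ... | e , 0<e , gap = fromℚ e , ⊏⇒< {0ℝ} {fromℚ e} (fromℚ-pos {e} 0<e) ,
              λ w dzw<e → lift (inj₂ (⊏-absorb (⊑-trans gap (⊑-trans (d-triangle x w z)
                (⊕-monoʳ (d x w) (d-sym w z)))) (<⇒⊏ {d z w} {fromℚ e} dzw<e)))
        U-cover : ∀ z → ∃ λ i → U i z
        U-cover z with em {∃ λ i → U i z}
        ... | yes found = found
        ... | no  ¬U = contradiction (z , dxz⊑t , z-min) none
          where
          z-min : ∀ y → d x y ⊑ t → f z ⊑ f y
          z-min y dxy⊑t with ⊑-or-⊐ (f z) (f y)
          ... | inj₁ le = le
          ... | inj₂ gt = contradiction ((y , dxy⊑t) , lift (inj₁ gt)) ¬U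
          centre : Ball
          centre = x , ⊑-trans (d-refl x) 0⊑t
          dxz⊑t : d x z ⊑ t
          dxz⊑t with ⊑-or-⊐ (d x z) t
          ... | inj₁ le = le
          ... | inj₂ gt = contradiction (centre , lift (inj₂ gt)) ¬U
        cover : ∃ λ (is : List Ball) → ∀ z → Any (λ i → U i z) is
        cover = compact Ball U U-open U-cover
        best-min : ∃ λ (j : Ball) → All (λ k → f (proj₁ j) ⊑ f (proj₁ k)) (proj₁ cover)
        best-min = argmin (x , ⊑-trans (d-refl x) 0⊑t) (proj₁ cover)
        best : X
        best = proj₁ (proj₁ best-min)
        absurd : ∀ (i : Ball) → f best ⊑ f (proj₁ i) × U i best → ⊥
        absurd _ (le , lift (inj₁ gt)) = ⊏⇒⋣ gt le
        absurd _ (le , lift (inj₂ gt)) = ⊏⇒⋣ gt (proj₂ (proj₁ best-min))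

  opaque
    max-on-ball : ∀ f → Lipschitz f → ∀ x t → 0ℝ ⊑ t →
      ∃ λ y → d x y ⊑ t × (∀ z → d x z ⊑ t → f z ⊑ f y)
    max-on-ball f lip x t 0⊑t =
      let y , dxy⊑t , y-min = min-on-ball (λ z → - f z) neg-lip x t 0⊑t
      in y , dxy⊑t , λ z dxz⊑t → neg-cancel-⊑ (y-min z dxz⊑t)
      where
      neg-lip : Lipschitz (λ z → - f z)
      neg-lip y z = neg-swap (⊑-trans (lip z y) (⊕-monoʳ (f y) (d-sym z y)))

  -- The maximum metric in coordinatewise form, which also makes sense for the empty tuple, where
  -- the inductions over coordinates start.
  Near : ∀ {n} → ℝ → Vector X n → Vector X n → Set
  Near t v w = ∀ i → d (v i) (w i) ⊑ t

  VLipschitz : ∀ {n} → (Vector X n → ℝ) → Set a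
  VLipschitz f = ∀ v w δ → 0ℝ ⊑ δ → Near δ v w → f v ⊑ f w ⊕ δ

  near-refl : ∀ {n δ} → 0ℝ ⊑ δ → (v : Vector X n) → Near δ v v
  near-refl 0⊑δ v i = ⊑-trans (d-refl (v i)) 0⊑δ

  near-∷ : ∀ {n δ x y} {v w : Vector X n} → d x y ⊑ δ → Near δ v w → Near δ (x Vector.∷ v) (y Vector.∷ w)
  near-∷ dxy vw zero    = dxy
  near-∷ dxy vw (suc i) = vw i

  near-η : ∀ {n δ} → 0ℝ ⊑ δ → (v : Vector X (suc n)) → Near δ (head v Vector.∷ tail v) v
  near-η 0⊑δ v zero    = ⊑-trans (d-refl (v zero)) 0⊑δ
  near-η 0⊑δ v (suc i) = ⊑-trans (d-refl (v (suc i))) 0⊑δ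

  opaque
    -- One coordinate is minimised at a time. The box for the remaining coordinates does not depend
    -- on the first one, so the partial minimum `g` is again Lipschitz and `min-on-ball` applies to
    -- it.
    min-on-box : ∀ n (f : Vector X n → ℝ) → VLipschitz f → ∀ c t → 0ℝ ⊑ t →
      ∃ λ v → Near t c v × (∀ w → Near t c w → f v ⊑ f w)
    -- Two empty tuples are functions that need not be propositionally equal; the Lipschitz bound
    -- with displacement `0ℝ` compares their values.
    min-on-box zero f lip c t 0⊑t = c , (λ ()) , λ w _ →
      ⊑-trans (lip c w 0ℝ ⊑-refl (λ ())) (proj₁ (⊕-identityʳ (f w)))
    min-on-box (suc n) f lip c t 0⊑t = y Vector.∷ m y , near-y∷my , minimal
      where
      rest : ∀ x → ∃ λ v → Near t (tail c) v × (∀ w → Near t (tail c) w → f (x Vector.∷ v) ⊑ f (x Vector.∷ w))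
      rest x = min-on-box n (λ v → f (x Vector.∷ v))
        (λ v w δ 0⊑δ vw → lip (x Vector.∷ v) (x Vector.∷ w) δ 0⊑δ (near-∷ (⊑-trans (d-refl x) 0⊑δ) vw))
        (tail c) t 0⊑t
      m : X → Vector X n
      m x = proj₁ (rest x)
      g : X → ℝ
      g x = f (x Vector.∷ m x)
      g-lip : Lipschitz g
      g-lip x y = ⊑-trans (proj₂ (proj₂ (rest x)) (m y) (proj₁ (proj₂ (rest y))))
        (lip (x Vector.∷ m y) (y Vector.∷ m y) (d x y) (d-nonNeg x y)
          (near-∷ ⊑-refl (near-refl (d-nonNeg x y) (m y))))
      best : ∃ λ y → d (head c) y ⊑ t × (∀ z → d (head c) z ⊑ t → g y ⊑ g z)
      best = min-on-ball g g-lip (head c) t 0⊑t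
      y : X
      y = proj₁ best
      near-y∷my : Near t c (y Vector.∷ m y)
      near-y∷my zero    = proj₁ (proj₂ best)
      near-y∷my (suc i) = proj₁ (proj₂ (rest y)) i
      minimal : ∀ w → Near t c w → f (y Vector.∷ m y) ⊑ f w
      minimal w cw = begin
        g y                         ≤⟨ proj₂ (proj₂ best) (head w) (cw zero) ⟩
        g (head w)                  ≤⟨ proj₂ (proj₂ (rest (head w))) (tail w) (λ i → cw (suc i)) ⟩
        f (head w Vector.∷ tail w)  ≤⟨ lip (head w Vector.∷ tail w) w 0ℝ ⊑-refl (near-η ⊑-refl w) ⟩
        f w ⊕ 0ℝ                    ≈⟨ ⊕-identityʳ (f w) ⟩
        f w                         ∎

  opaque
    finite-net : ∀ {e} → 0ℚ ℚ.< e → ∃ λ (xs : List X) → ∀ x → Any (λ y → d x y ⊑ fromℚ e) xs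
    finite-net {e} 0<e = let xs , covers = compact X U U-open U-cover in
      xs , λ x → Any.map (λ {y} dyx⊏e → ⊑-trans (d-sym x y) (⊏⇒⊑ (lower dyx⊏e))) (covers x)
      where
      U : X → Pred X a
      U y z = Lift a (d y z ⊏ fromℚ e)
      U-open : ∀ y → IsOpen M (U y)
      U-open y z (lift dyz⊏e) with ⊏⇒gap dyz⊏e
      ... | e′ , 0<e′ , gap = fromℚ e′ , ⊏⇒< {0ℝ} {fromℚ e′} (fromℚ-pos {e′} 0<e′) ,
            λ w dzw<e′ → lift (⊑-⊏-trans (d-triangle y z w)
              (⊏-⊑-trans (⊕-monoʳ-⊏ (d y z) (<⇒⊏ {d z w} {fromℚ e′} dzw<e′)) gap))
      U-cover : ∀ z → ∃ λ y → U y z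
      U-cover z = z , lift (⊑-⊏-trans (d-refl z) (fromℚ-pos {e} 0<e))

  -- The pattern shared by the choice of a time and the choice of an agility: `Stable` says that
  -- goodness survives joining with anything, so finitely many good parameters can be merged into
  -- one.
  module Uniform {b} {A : Set b} (_∨_ : A → A → A) (a₀ : A) where

    Stable : ∀ {c} → (A → Set c) → Set _
    Stable Q = (∀ α β → Q α → Q (α ∨ β)) × (∀ α β → Q β → Q (α ∨ β))

    finite-uniform : ∀ {c} (Q : X → A → Set c) → (∀ x → Stable (Q x)) → (∀ x → ∃ (Q x)) →
      ∀ xs → ∃ λ α → All (λ x → Q x α) xs
    finite-uniform Q stable q []       = a₀ , []
    finite-uniform Q stable q (x ∷ xs) =
      let α , qx = q x ; β , qxs = finite-uniform Q stable q xs
      in α ∨ β , proj₁ (stable x) α β qx ∷ All.map (λ {y} → proj₂ (stable y) α β) qxs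

    -- For a fixed first coordinate `x` the induction hypothesis yields one parameter good near all
    -- remaining coordinates; these parameters are joined over a finite net of `x`. The witness `w`
    -- therefore has its first coordinate in the net.
    uniform : ∀ {c} n (P : Vector X n → A → Set c) → (∀ v → Stable (P v)) → (∀ v → ∃ (P v)) →
      ∀ {e} → 0ℚ ℚ.< e → ∃ λ α → ∀ v → ∃ λ w → Near (fromℚ e) v w × P w α
    uniform zero    P stable p 0<e = let α , pα = p Vector.[] in α , λ v → Vector.[] , (λ ()) , pα
    uniform (suc n) P stable p {e} 0<e = α , near-good
      where
      Q : X → A → Set _
      Q x α = ∀ v → ∃ λ w → Near (fromℚ e) v w × P (x Vector.∷ w) α
      Q-stable : ∀ x → Stable (Q x)
      Q-stable x =
        (λ α β q v → let w , vw , pw = q v in w , vw , proj₁ (stable (x Vector.∷ w)) α β pw) ,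
        (λ α β q v → let w , vw , pw = q v in w , vw , proj₂ (stable (x Vector.∷ w)) α β pw)
      net = finite-net 0<e
      common = finite-uniform Q Q-stable
        (λ x → uniform n (λ v → P (x Vector.∷ v)) (λ v → stable (x Vector.∷ v)) (λ v → p (x Vector.∷ v)) 0<e)
        (proj₁ net)
      α : A
      α = proj₁ common
      near-good : ∀ v → ∃ λ w → Near (fromℚ e) v w × P w α
      near-good v with All.lookupAny (proj₂ common) (proj₂ net (head v))
      ... | good , close with good (tail v)
      ... | w , vw , pw = _ Vector.∷ w , (λ { zero → close ; (suc i) → vw i }) , pw

⊏-dense : ∀ {x} → 0ℝ ⊏ x → ∃ λ e → 0ℚ ℚ.< e × fromℚ e ⊏ x
⊏-dense {x} 0⊏x with ⊏⇒gap 0⊏x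
... | e , 0<e , gap = e ℚ.* ½ , half-pos 0<e , gap⇒⊏ {e = e ℚ.* ½} (half-pos 0<e)
  (⊑-trans (proj₁ (fromℚ-+-≡ {e ℚ.* ½} {e} {e ℚ.* ½} (ε/2+ε/2≡ε e))) (⊑-trans (proj₂ (⊕-identityˡ (fromℚ e))) gap))

-- Geodesics and intermediate points

module GeodesicSpace {a ℓ : Level} (em : ExcludedMiddle a)
                     (M : MetricSpace a ℓ) (geodesic : IsGeodesic M) where
  open Classical em
  open Completeness em
  open Metric M

  0𝕀 1𝕀 : 𝕀
  0𝕀 = 0ℝ , ⊑⇒≤ {0ℝ} {0ℝ} ⊑-refl , ⊑⇒≤ {0ℝ} {1ℝ} (fromℚ-nonNeg {1ℚ} (ℚ.positive⁻¹ 1ℚ))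
  1𝕀 = 1ℝ , ⊑⇒≤ {0ℝ} {1ℝ} (fromℚ-nonNeg {1ℚ} (ℚ.positive⁻¹ 1ℚ)) , ⊑⇒≤ {1ℝ} {1ℝ} ⊑-refl

  module Path {x y : X} {γ : 𝕀 → X} (path : IsPath M x y γ) (isLength : IsLength M γ (d x y)) where

    private
      continuous : IsContinuous M γ
      continuous = proj₁ path

    near : ∀ (s : 𝕀) {e} → 0ℚ ℚ.< e → ∃ λ η → 0ℚ ℚ.< η ×
      (∀ (s′ : 𝕀) → proj₁ s ⊑ proj₁ s′ ⊕ fromℚ η → proj₁ s′ ⊑ proj₁ s ⊕ fromℚ η →
        d (γ s) (γ s′) ⊑ fromℚ e)
    near s {e} 0<e =
      let δ , 0<δ , close = continuous s (fromℚ e)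
            (⊏⇒< {0ℝ} {fromℚ e} (fromℚ-pos {e} 0<e))
          η , 0<η , η⊏δ = ⊏-dense (<⇒⊏ {0ℝ} {δ} 0<δ)
      in η , 0<η , λ s′ le ge → ⊏⇒⊑ {d (γ s) (γ s′)} {fromℚ e} (<⇒⊏ {d (γ s) (γ s′)} {fromℚ e}
           (close s′ (distance-< {proj₁ s} {proj₁ s′} {δ} η le ge η⊏δ)))

    start : d x (γ 0𝕀) ⊑ 0ℝ
    start = ⊑-trans (d-sym x (γ 0𝕀))
      (≈⇒d⊑0 (proj₁ (proj₂ path) 0𝕀 (≃-refl 0ℝ)))

    end : d (γ 1𝕀) y ⊑ 0ℝ
    end = ≈⇒d⊑0 (proj₂ (proj₂ path) 1𝕀 (≃-refl 1ℝ))

    -- Inscribed sums never exceed the length, and the length is `d x y`; the partition with nodes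
    -- 0, `s`, 1 makes every point of the path lie metrically between the end points.
    additive : ∀ s → d x (γ s) ⊕ d (γ s) y ⊑ d x y
    additive s = begin
      d x z ⊕ d z y
        ≤⟨ ⊕-mono-⊑ (d-triangle x (γ 0𝕀) z) (d-triangle z (γ 1𝕀) y) ⟩
      (d x (γ 0𝕀) ⊕ d (γ 0𝕀) z) ⊕ (d z (γ 1𝕀) ⊕ d (γ 1𝕀) y)
        ≤⟨ ⊕-mono-⊑ (⊕-monoˡ (d (γ 0𝕀) z) start) (⊕-monoʳ (d z (γ 1𝕀)) end) ⟩
      (0ℝ ⊕ d (γ 0𝕀) z) ⊕ (d z (γ 1𝕀) ⊕ 0ℝ)
        ≈⟨ ⊕-cong (⊕-identityˡ (d (γ 0𝕀) z)) (≋-refl {d z (γ 1𝕀) ⊕ 0ℝ}) ⟩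
      d (γ 0𝕀) z ⊕ (d z (γ 1𝕀) ⊕ 0ℝ)
        ≤⟨ subst (_⊑ d x y) sealed (≤⇒⊑ {two-steps} {d x y} bound) ⟩
      d x y ∎
      where
      z = γ s
      points : Vector 𝕀 3
      points = 0𝕀 Vector.∷ s Vector.∷ 1𝕀 Vector.∷ Vector.[]
      two-steps : ℝ
      two-steps = d (γ 0𝕀) z + (d z (γ 1𝕀) + 0ℝ)
      partition : IsPartition M 2 points
      partition = ≃-refl 0ℝ , ≃-refl 1ℝ ,
                  λ { zero → proj₁ (proj₂ s) ; (suc zero) → proj₂ (proj₂ s) }
      bound : two-steps ≤ d x y
      bound = proj₁ isLength two-steps (2 , points , partition , ≃-refl two-steps)
      sealed : two-steps ≡ d (γ 0𝕀) z ⊕ (d z (γ 1𝕀) ⊕ 0ℝ)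
      sealed = sym (trans (⊕≡+ (d (γ 0𝕀) z) (d z (γ 1𝕀) ⊕ 0ℝ))
        (cong (λ w → d (γ 0𝕀) z + w) (⊕≡+ (d z (γ 1𝕀)) 0ℝ)))

    module _ {t : ℝ} (0⊑t : 0ℝ ⊑ t) (t⊏dxy : t ⊏ d x y) where

      -- An intermediate value argument for the distance from `x` along the path: at the supremum of
      -- the early parameters this distance is exactly `t`, by continuity from both sides.
      Early : Pred ℝ a
      Early s = Lift a (∃ λ p → d x (γ (s , p)) ⊑ t)

      opaque
        last : ∃ (IsSup Early)
        last = sup-exists Early 1ℝ (0ℝ , lift (proj₂ 0𝕀 , ⊑-trans start 0⊑t))
          (λ s s-early → proj₂ (proj₁ (lower s-early)))

      σ : 𝕀
      σ = proj₁ last ,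
        proj₁ (proj₂ last) 0ℝ (lift (proj₂ 0𝕀 , ⊑-trans start 0⊑t)) ,
        proj₂ (proj₂ last) 1ℝ (λ s s-early → proj₂ (proj₁ (lower s-early)))

      s₀ : ℝ
      s₀ = proj₁ σ

      last-ub : ∀ {s} → Early s → s ⊑ s₀
      last-ub {s} s-early = ≤⇒⊑ {s} {s₀} (proj₁ (proj₂ last) s s-early)

      last-within : d x (γ σ) ⊑ t
      last-within = ⊑-limit λ e 0<e → via e (near σ 0<e)
        where
        via : ∀ e → (∃ λ η → 0ℚ ℚ.< η × (∀ (s′ : 𝕀) → s₀ ⊑ proj₁ s′ ⊕ fromℚ η →
                proj₁ s′ ⊑ s₀ ⊕ fromℚ η → d (γ σ) (γ s′) ⊑ fromℚ e)) → d x (γ σ) ⊑ t ⊕ fromℚ e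
        via e (η , 0<η , close) =
          let s , lift (p , le) , s₀⊑s+η = sup-approx Early {s₀} (proj₂ last) {η} 0<η
          in ⊑-trans (d-triangle x (γ (s , p)) (γ σ))
               (⊕-mono-⊑ le (⊑-trans (d-sym (γ (s , p)) (γ σ)) (close (s , p) s₀⊑s+η
                 (⊑-trans (last-ub {s} (lift (p , le))) (x⊑x⊕y s₀ (fromℚ-nonNeg {η} 0<η))))))

      -- No parameter past the supremum is early. If `s₀ ⊕ fromℚ η` leaves the unit interval, the
      -- end of the path serves instead, because `t ⊏ d x y`.
      late : ∀ {η} → 0ℚ ℚ.< η → ∃ λ (s : 𝕀) → s₀ ⊑ proj₁ s × proj₁ s ⊑ s₀ ⊕ fromℚ η × t ⊑ d x (γ s)
      late {η} 0<η = [ inside , beyond ]′ (⊑-or-⊐ (s₀ ⊕ fromℚ η) 1ℝ)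
        where
        s₀⊑s₀+η : s₀ ⊑ s₀ ⊕ fromℚ η
        s₀⊑s₀+η = x⊑x⊕y s₀ (fromℚ-nonNeg {η} 0<η)
        inside : s₀ ⊕ fromℚ η ⊑ 1ℝ →
          ∃ λ (s : 𝕀) → s₀ ⊑ proj₁ s × proj₁ s ⊑ s₀ ⊕ fromℚ η × t ⊑ d x (γ s)
        inside s₀+η⊑1 = (s₀ ⊕ fromℚ η , p) , s₀⊑s₀+η , ⊑-refl ,
          [ (λ le → contradiction (last-ub (lift (p , le))) (⊏⇒⋣ (x⊏x⊕e s₀ {η} 0<η))) , ⊏⇒⊑ ]′
            (⊑-or-⊐ (d x (γ (s₀ ⊕ fromℚ η , p))) t)
          where
          p : 0ℝ ≤ s₀ ⊕ fromℚ η × s₀ ⊕ fromℚ η ≤ 1ℝ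
          p = ⊑⇒≤ {0ℝ} {s₀ ⊕ fromℚ η} (⊑-trans (≤⇒⊑ {0ℝ} {s₀} (proj₁ (proj₂ σ))) s₀⊑s₀+η) ,
              ⊑⇒≤ {s₀ ⊕ fromℚ η} {1ℝ} s₀+η⊑1
        beyond : 1ℝ ⊏ s₀ ⊕ fromℚ η →
          ∃ λ (s : 𝕀) → s₀ ⊑ proj₁ s × proj₁ s ⊑ s₀ ⊕ fromℚ η × t ⊑ d x (γ s)
        beyond 1⊏s₀+η = 1𝕀 , ≤⇒⊑ {s₀} {1ℝ} (proj₂ (proj₂ σ)) , ⊏⇒⊑ 1⊏s₀+η ,
          ⊑-trans (⊏⇒⊑ t⊏dxy) (⊑-trans (d-triangle x (γ 1𝕀) y)
            (⊑-trans (⊕-monoʳ (d x (γ 1𝕀)) end) (proj₁ (⊕-identityʳ (d x (γ 1𝕀))))))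

      last-reaches : t ⊑ d x (γ σ)
      last-reaches = ⊑-limit λ e 0<e → via e (near σ 0<e)
        where
        via : ∀ e → (∃ λ η → 0ℚ ℚ.< η × (∀ (s′ : 𝕀) → s₀ ⊑ proj₁ s′ ⊕ fromℚ η →
                proj₁ s′ ⊑ s₀ ⊕ fromℚ η → d (γ σ) (γ s′) ⊑ fromℚ e)) → t ⊑ d x (γ σ) ⊕ fromℚ e
        via e (η , 0<η , close) =
          let s , s₀⊑s , s⊑s₀+η , t⊑ = late {η} 0<η
          in ⊑-trans t⊑ (⊑-trans (d-triangle x (γ σ) (γ s)) (⊕-monoʳ (d x (γ σ))
               (close s (⊑-trans s₀⊑s (x⊑x⊕y (proj₁ s) (fromℚ-nonNeg {η} 0<η))) s⊑s₀+η)))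

    advance : ∀ {s t} → 0ℝ ⊑ t → t ⊏ d x y → d x y ⊑ s ⊕ t → ∃ λ z → d x z ⊑ t × d z y ⊑ s
    advance {s} {t} 0⊑t t⊏dxy dxy⊑s+t = z , last-within 0⊑t t⊏dxy , ⊕-cancelʳ-⊑ t (begin
      d z y ⊕ t      ≈⟨ ⊕-comm (d z y) t ⟩
      t ⊕ d z y      ≤⟨ ⊕-monoˡ (d z y) (last-reaches 0⊑t t⊏dxy) ⟩
      d x z ⊕ d z y  ≤⟨ additive (σ 0⊑t t⊏dxy) ⟩
      d x y          ≤⟨ dxy⊑s+t ⟩
      s ⊕ t          ∎)
      where
      z : X
      z = γ (σ 0⊑t t⊏dxy)

  opaque
    -- The only form in which geodesics enter the game: a displacement can be divided into two of
    -- prescribed sizes. If `y` is already within `t`, it serves as its own intermediate point.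
    between : ∀ x y {s t} → 0ℝ ⊑ s → 0ℝ ⊑ t → d x y ⊑ s ⊕ t → ∃ λ z → d x z ⊑ t × d z y ⊑ s
    between x y {s} {t} 0⊑s 0⊑t dxy⊑s+t =
      [ (λ dxy⊑t → y , dxy⊑t , ⊑-trans (d-refl y) 0⊑s)
      , (λ t⊏dxy → advance {s} {t} 0⊑t t⊏dxy dxy⊑s+t)
      ]′ (⊑-or-⊐ (d x y) t)
      where
      γ : 𝕀 → X
      γ = proj₁ (geodesic x y)
      path : IsPath M x y γ
      path = proj₁ (proj₂ (geodesic x y))
      isLength : IsLength M γ (d x y)
      isLength = proj₂ (proj₂ (geodesic x y))
      open Path {x} {y} {γ} path isLength using (advance)

-- Finite minima and maxima

minimum-⊑ : ∀ {n} .{{_ : NonZero n}} (v : Vector ℝ n) i → minimum v ⊑ v i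
minimum-⊑ {suc n} v zero    = go n (tail v)
  where
  go : ∀ n (w : Vector ℝ n) → Vector.foldr _⊓_ (head v) w ⊑ head v
  go zero    w = ⊑-refl
  go (suc n) w = ⊑-trans (x⊓y⊑y (head w) (Vector.foldr _⊓_ (head v) (tail w))) (go n (tail w))
minimum-⊑ {suc n} v (suc i) = go n (tail v) i
  where
  go : ∀ n (w : Vector ℝ n) i → Vector.foldr _⊓_ (head v) w ⊑ w i
  go (suc n) w zero    = x⊓y⊑x (head w) (Vector.foldr _⊓_ (head v) (tail w))
  go (suc n) w (suc i) = ⊑-trans (x⊓y⊑y (head w) (Vector.foldr _⊓_ (head v) (tail w))) (go n (tail w) i)

module _ {a : Level} (em : ExcludedMiddle a) where
  open Classical em

  minimum-attained : ∀ {n} .{{_ : NonZero n}} (v : Vector ℝ n) → ∃ λ i → v i ⊑ minimum v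
  minimum-attained {suc n} v = go n (tail v) (zero , ⊑-refl) λ i → suc i , ⊑-refl
    where
    go : ∀ n (w : Vector ℝ n) → (∃ λ i → v i ⊑ head v) → (∀ j → ∃ λ i → v i ⊑ w j) →
         ∃ λ i → v i ⊑ Vector.foldr _⊓_ (head v) w
    go zero    w here there = here
    go (suc n) w here there =
      let m = Vector.foldr _⊓_ (head v) (tail w)
          i , vi⊑m = go n (tail w) here (λ j → there (suc j))
          j , vj⊑w = there zero
      in [ (λ le → j , ⊓-glb vj⊑w (⊑-trans vj⊑w le))
         , (λ gt → i , ⊓-glb (⊑-trans vi⊑m (⊏⇒⊑ gt)) vi⊑m) ]′ (⊑-or-⊐ (head w) m)

maximum-⊑ : ∀ {n} .{{_ : NonZero n}} (v : Vector ℝ n) {t} → (∀ i → v i ⊑ t) → maximum v ⊑ t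
maximum-⊑ {suc n} v {t} v⊑t = go n (tail v) (λ i → v⊑t (suc i))
  where
  go : ∀ n (w : Vector ℝ n) → (∀ i → w i ⊑ t) → Vector.foldr _⊔_ (head v) w ⊑ t
  go zero    w w⊑t = v⊑t zero
  go (suc n) w w⊑t = ⊔-lub (w⊑t zero) (go n (tail w) (λ i → w⊑t (suc i)))

⊑-maximum : ∀ {n} .{{_ : NonZero n}} (v : Vector ℝ n) i → v i ⊑ maximum v
⊑-maximum {suc n} v zero    = go n (tail v)
  where
  go : ∀ n (w : Vector ℝ n) → head v ⊑ Vector.foldr _⊔_ (head v) w
  go zero    w = ⊑-refl
  go (suc n) w = ⊑-trans (go n (tail w)) (y⊑x⊔y (head w) (Vector.foldr _⊔_ (head v) (tail w)))
⊑-maximum {suc n} v (suc i) = go n (tail v) i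
  where
  go : ∀ n (w : Vector ℝ n) i → w i ⊑ Vector.foldr _⊔_ (head v) w
  go (suc n) w zero    = x⊑x⊔y (head w) (Vector.foldr _⊔_ (head v) (tail w))
  go (suc n) w (suc i) = ⊑-trans (go n (tail w) i) (y⊑x⊔y (head w) (Vector.foldr _⊔_ (head v) (tail w)))

-- The game as an iteration of operators on payoffs

module Values {a ℓ : Level} (em : ExcludedMiddle a) (M : MetricSpace a ℓ)
              (compact : IsCompact M) (geodesic : IsGeodesic M)
              (k : ℕ) .{{k≢0 : NonZero k}} where
  open Classical em
  open Metric M
  open CompactSpace em M compact
  open GeodesicSpace em M geodesic
  open Game M k

  -- A function of the position bundled with the bound that makes its extrema over balls attained,
  -- so that a step of the game maps payoffs to payoffs.
  record Payoff : Set a where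
    field
      at  : X → Vector X k → ℝ
      lip : ∀ r r′ c c′ {δ δ′} → 0ℝ ⊑ δ → 0ℝ ⊑ δ′ → d r r′ ⊑ δ → Near δ′ c c′ →
            at r c ⊑ at r′ c′ ⊕ (δ ⊕ δ′)

  open Payoff

  distance : Payoff
  distance .at = distToCops
  distance .lip r r′ c c′ {δ} {δ′} 0⊑δ 0⊑δ′ rr′ cc′ =
    let i , attained = minimum-attained em (map (d r′) c′) in begin
      distToCops r c                    ≤⟨ minimum-⊑ (map (d r) c) i ⟩
      d r (c i)                         ≤⟨ d-triangle r r′ (c i) ⟩
      d r r′ ⊕ d r′ (c i)               ≤⟨ ⊕-mono-⊑ rr′ (d-triangle r′ (c′ i) (c i)) ⟩
      δ ⊕ (d r′ (c′ i) ⊕ d (c′ i) (c i)) ≤⟨ ⊕-monoʳ δ (⊕-mono-⊑ attained (⊑-trans (d-sym (c′ i) (c i)) (cc′ i))) ⟩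
      δ ⊕ (distToCops r′ c′ ⊕ δ′)       ≈⟨ ⊕-Solver.solve 3
           (λ δ m δ′ → δ ⊕′ (m ⊕′ δ′) ⊜ m ⊕′ (δ ⊕′ δ′)) ≋-refl δ (distToCops r′ c′) δ′ ⟩
      distToCops r′ c′ ⊕ (δ ⊕ δ′)       ∎

  module Step (t : ℝ) (0⊑t : 0ℝ ⊑ t) (F : Payoff) where

    private
      F-vlip : ∀ r → VLipschitz (at F r)
      F-vlip r c c′ δ 0⊑δ cc′ = ⊑-trans (lip F r r c c′ ⊑-refl 0⊑δ (d-refl r) cc′)
        (⊕-monoʳ (at F r c′) (proj₁ (⊕-identityˡ δ)))

      best-reply-to : ∀ r c → ∃ λ c′ → Near t c c′ × (∀ c″ → Near t c c″ → at F r c′ ⊑ at F r c″)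
      best-reply-to r c = min-on-box k (at F r) (F-vlip r) c t 0⊑t

    reply : X → Vector X k → Vector X k
    reply r c = proj₁ (best-reply-to r c)

    reply-near : ∀ r c → Near t c (reply r c)
    reply-near r c = proj₁ (proj₂ (best-reply-to r c))

    after : X → Vector X k → ℝ
    after r c = at F r (reply r c)

    after-min : ∀ r c c′ → Near t c c′ → after r c ⊑ at F r c′
    after-min r c = proj₂ (proj₂ (best-reply-to r c))

    private
      after-lip : ∀ c → Lipschitz (λ r → after r c)
      after-lip c r r′ = ⊑-trans (after-min r c (reply r′ c) (reply-near r′ c))
        (⊑-trans (lip F r r′ (reply r′ c) (reply r′ c) (d-nonNeg r r′) ⊑-refl ⊑-refl (near-refl ⊑-refl (reply r′ c)))
        (⊕-monoʳ (after r′ c) (proj₁ (⊕-identityʳ (d r r′)))))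

      best-move-from : ∀ r c → ∃ λ r′ → d r r′ ⊑ t × (∀ r″ → d r r″ ⊑ t → after r″ c ⊑ after r′ c)
      best-move-from r c = max-on-ball (λ r′ → after r′ c) (after-lip c) r t 0⊑t

    move : X → Vector X k → X
    move r c = proj₁ (best-move-from r c)

    move-near : ∀ r c → d r (move r c) ⊑ t
    move-near r c = proj₁ (proj₂ (best-move-from r c))

    stepped : X → Vector X k → ℝ
    stepped r c = after (move r c) c

    stepped-max : ∀ r c r′ → d r r′ ⊑ t → after r′ c ⊑ stepped r c
    stepped-max r c = proj₂ (proj₂ (best-move-from r c))

    -- A simulation in both directions: the robber's best move from `r` is shadowed from `r′` within
    -- `δ`, and the cops' reply to the shadow is shadowed back from `c` within `δ′`. Both shadows
    -- come from `between`, and the constant stays 1.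
    stepped-lip : ∀ r r′ c c′ {δ δ′} → 0ℝ ⊑ δ → 0ℝ ⊑ δ′ → d r r′ ⊑ δ → Near δ′ c c′ →
                  stepped r c ⊑ stepped r′ c′ ⊕ (δ ⊕ δ′)
    stepped-lip r r′ c c′ {δ} {δ′} 0⊑δ 0⊑δ′ rr′ cc′ = begin
      stepped r c                    ≤⟨ after-min r₁ c (λ i → proj₁ (c₁ i)) (λ i → proj₁ (proj₂ (c₁ i))) ⟩
      at F r₁ (λ i → proj₁ (c₁ i))   ≤⟨ lip F r₁ r₁′ (λ i → proj₁ (c₁ i)) c₁′ 0⊑δ 0⊑δ′
                                          (⊑-trans (d-sym r₁ r₁′) (proj₂ (proj₂ mid))) (λ i → proj₂ (proj₂ (c₁ i))) ⟩
      after r₁′ c′ ⊕ (δ ⊕ δ′)        ≤⟨ ⊕-monoˡ (δ ⊕ δ′) (stepped-max r′ c′ r₁′ (proj₁ (proj₂ mid))) ⟩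
      stepped r′ c′ ⊕ (δ ⊕ δ′)       ∎
      where
      r₁ : X
      r₁ = move r c
      mid : ∃ λ z → d r′ z ⊑ t × d z r₁ ⊑ δ
      mid = between r′ r₁ 0⊑δ 0⊑t (⊑-trans (d-triangle r′ r r₁)
        (⊕-mono-⊑ (⊑-trans (d-sym r′ r) rr′) (move-near r c)))
      r₁′ : X
      r₁′ = proj₁ mid
      c₁′ : Vector X k
      c₁′ = reply r₁′ c′
      c₁ : ∀ i → ∃ λ z → d (c i) z ⊑ t × d z (c₁′ i) ⊑ δ′
      c₁ i = between (c i) (c₁′ i) 0⊑δ′ 0⊑t (⊑-trans (d-triangle (c i) (c′ i) (c₁′ i))
        (⊕-mono-⊑ (cc′ i) (reply-near r₁′ c′ i)))

    opaque
      step : Payoff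
      step = record { at = stepped ; lip = stepped-lip }

      at-step : ∀ r c → at step r c ≡ stepped r c
      at-step r c = refl

      -- Together with `best-reply` this gives the two players' strategies. Comparisons of payoffs
      -- below play the robber's best move in the smaller game against suitable cop moves.
      best-move : ∀ r c → ∃ λ r′ → d r r′ ⊑ t × (∀ c′ → Near t c c′ → at step r c ⊑ at F r′ c′)
      best-move r c = move r c , move-near r c , after-min (move r c) c

      best-reply : ∀ r c r′ → d r r′ ⊑ t → ∃ λ c′ → Near t c c′ × at F r′ c′ ⊑ at step r c
      best-reply r c r′ rr′ = reply r′ c , reply-near r′ c , stepped-max r c r′ rr′

  open Step public using (step; best-move; best-reply)

  infix 4 _⊴_

  record _⊴_ (F G : Payoff) : Set a where
    constructor mk⊴
    field at-⊑ : ∀ r c → at F r c ⊑ at G r c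

  open _⊴_ public

  ⊴-refl : ∀ {F} → F ⊴ F
  ⊴-refl = mk⊴ λ r c → ⊑-refl

  ⊴-trans : ∀ {F G H} → F ⊴ G → G ⊴ H → F ⊴ H
  ⊴-trans F⊴G G⊴H = mk⊴ λ r c → ⊑-trans (at-⊑ F⊴G r c) (at-⊑ G⊴H r c)

  step-mono : ∀ {t} (p : 0ℝ ⊑ t) {F G} → F ⊴ G → step t p F ⊴ step t p G
  step-mono {t} p {F} {G} F⊴G = mk⊴ λ r c →
    let r′ , rr′ , bound = best-move t p F r c
        c′ , cc′ , reached = best-reply t p G r c r′ rr′
    in ⊑-trans (bound c′ cc′) (⊑-trans (at-⊑ F⊴G r′ c′) reached)

  -- In two shorter steps the robber can still walk to the point of the long
  -- step, and the cops then know no more than they knew before.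
  step-split : ∀ {s t u} (p : 0ℝ ⊑ s) (q : 0ℝ ⊑ t) (o : 0ℝ ⊑ u) → s ⊕ t ≋ u → ∀ F →
               step u o F ⊴ step s p (step t q F)
  step-split {s} {t} {u} p q o s+t≋u F = mk⊴ λ r c →
    let r₂ , rr₂ , bound = best-move u o F r c
        r₁ , rr₁ , r₁r₂ = between r r₂ q p (⊑-trans rr₂ (⊑-trans (proj₂ s+t≋u) (proj₁ (⊕-comm s t))))
        c₁ , cc₁ , reached₁ = best-reply s p (step t q F) r c r₁ rr₁
        c₂ , c₁c₂ , reached₂ = best-reply t q F r₁ c₁ r₂ r₁r₂
    in ⊑-trans (bound c₂ λ i → ⊑-trans (d-triangle (c i) (c₁ i) (c₂ i))
                (⊑-trans (⊕-mono-⊑ (cc₁ i) (c₁c₂ i)) (proj₁ s+t≋u)))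
       (⊑-trans reached₂ reached₁)

  -- Covers a step of length zero that is subdivided into no steps at all. The cops stay, and the
  -- robber ends at distance zero from `r`, which the Lipschitz bound turns into equal payoffs.
  step-zero : ∀ {t} (p : 0ℝ ⊑ t) → t ⊑ 0ℝ → ∀ F → step t p F ⊴ F
  step-zero {t} p t⊑0 F = mk⊴ λ r c →
    let r′ , rr′ , bound = best-move t p F r c
    in ⊑-trans (bound c (near-refl p c))
       (⊑-trans (lip F r′ r c c {0ℝ} {0ℝ} ⊑-refl ⊑-refl (⊑-trans (d-sym r′ r) (⊑-trans rr′ t⊑0)) (near-refl ⊑-refl c))
       (proj₁ (≋-trans (⊕-cong ≋-refl (⊕-identityʳ 0ℝ)) (⊕-identityʳ (at F r c)))))

  -- Every cop can follow the robber along a geodesic without losing ground.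
  step-distance : ∀ {t} (p : 0ℝ ⊑ t) → step t p distance ⊴ distance
  step-distance {t} p = mk⊴ λ r c →
    let r′ , rr′ , bound = best-move t p distance r c
        follow = λ i → between (c i) r′ (d-nonNeg (c i) r) p
          (⊑-trans (d-triangle (c i) r r′) (⊕-monoʳ (d (c i) r) rr′))
        c′ = λ i → proj₁ (follow i)
        i , attained = minimum-attained em (map (d r) c)
    in begin
      at (step t p distance) r c  ≤⟨ bound c′ (λ i → proj₁ (proj₂ (follow i))) ⟩
      distToCops r′ c′            ≤⟨ minimum-⊑ (map (d r′) c′) i ⟩
      d r′ (c′ i)                 ≤⟨ d-sym r′ (c′ i) ⟩
      d (c′ i) r′                 ≤⟨ proj₂ (proj₂ (follow i)) ⟩
      d (c i) r                   ≤⟨ d-sym (c i) r ⟩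
      d r (c i)                   ≤⟨ attained ⟩
      distToCops r c              ∎

  nonNeg : (t : ℝ₊) → 0ℝ ⊑ proj₁ t
  nonNeg (t , 0≤t) = ≤⇒⊑ {0ℝ} {t} 0≤t

  -- Lists replace vectors because cutting and merging agilities changes their length.
  payoff : List ℝ₊ → Payoff
  payoff []      = distance
  payoff (t ∷ τ) = step (proj₁ t) (nonNeg t) (payoff τ)

  val : List ℝ₊ → X → Vector X k → ℝ
  val τ = at (payoff τ)

  -- The robber can stay where he is in every step.
  val-nonNeg : ∀ τ r c → 0ℝ ⊑ val τ r c
  val-nonNeg [] r c = let i , attained = minimum-attained em (map (d r) c) in
    ⊑-trans (d-nonNeg r (c i)) attained
  val-nonNeg (t ∷ τ) r c =
    let c′ , _ , reached = best-reply (proj₁ t) (nonNeg t) (payoff τ) r c r (⊑-trans (d-refl r) (nonNeg t))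
    in ⊑-trans (val-nonNeg τ r c′) reached

  distCops-≤ : ∀ {c c′ t} → Near t c c′ → distCops c c′ ≤ t
  distCops-≤ {c} {c′} {t} cc′ = ⊑⇒≤ {distCops c c′} {t} (maximum-⊑ (zipWith d c c′) cc′)

  ≤-near : ∀ c c′ t → distCops c c′ ≤ t → Near t c c′
  ≤-near c c′ t le i = ⊑-trans (⊑-maximum (zipWith d c c′) i) (≤⇒⊑ {distCops c c′} {t} le)

  after : ∀ {N} → FiniteAgility (suc N) → X → Vector X k → ℝ
  after τ = Step.after (proj₁ (head τ)) (nonNeg (head τ)) (payoff (toList (tail τ)))

  -- Existence and uniqueness are proved together: to show that a value is a maximum or minimum, all
  -- competing values must be bounded, and those are known only through their relation.
  isVal        : ∀ N τ r c → IsVal r c N τ (val (toList τ) r c)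
  isVal-unique : ∀ N τ r c v → IsVal r c N τ v → v ≋ val (toList τ) r c
  isValAfter        : ∀ N τ r c → IsValAfter r c N τ (after τ r c)
  isValAfter-unique : ∀ N τ r c v → IsValAfter r c N τ v → v ≋ after τ r c

  isVal zero    τ r c = lift (≃-refl (distToCops r c))
  isVal (suc N) τ r c = subst (IsVal r c (suc N) τ) (sym (S.at-step r c)) (
    (S.move r c , ⊑⇒≤ {d r (S.move r c)} {t} (S.move-near r c) , isValAfter N τ (S.move r c) c) ,
    λ { w (r′ , rr′ , w-after) → ⊑⇒≤ {w} {S.stepped r c}
        (⊑-trans (proj₁ (isValAfter-unique N τ r′ c w w-after))
                 (S.stepped-max r c r′ (≤⇒⊑ {d r r′} {t} rr′))) })
    where
    t : ℝ
    t = proj₁ (head τ)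
    module S = Step t (nonNeg (head τ)) (payoff (toList (tail τ)))

  isVal-unique zero    τ r c v (lift (v≤ , ≤v)) =
    ≤⇒⊑ {v} {distToCops r c} v≤ , ≤⇒⊑ {distToCops r c} {v} ≤v
  isVal-unique (suc N) τ r c v ((r′ , rr′ , v-after) , v-ub) =
    subst (v ⊑_) (sym (S.at-step r c))
      (⊑-trans (proj₁ (isValAfter-unique N τ r′ c v v-after)) (S.stepped-max r c r′ (≤⇒⊑ {d r r′} {t} rr′))) ,
    ≤⇒⊑ {at S.step r c} {v} (v-ub (at S.step r c) (proj₁ (isVal (suc N) τ r c)))
    where
    t : ℝ
    t = proj₁ (head τ)
    module S = Step t (nonNeg (head τ)) (payoff (toList (tail τ)))

  isValAfter N τ r c =
    (S.reply r c , distCops-≤ (S.reply-near r c) , isVal N (tail τ) r (S.reply r c)) ,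
    λ { w (c′ , cc′ , w-val) → ⊑⇒≤ {S.after r c} {w}
        (⊑-trans (S.after-min r c c′ (≤-near c c′ t cc′))
                 (proj₂ (isVal-unique N (tail τ) r c′ w w-val))) }
    where
    t : ℝ
    t = proj₁ (head τ)
    module S = Step t (nonNeg (head τ)) (payoff (toList (tail τ)))

  isValAfter-unique N τ r c v ((c′ , cc′ , v-val) , v-lb) =
    ≤⇒⊑ {v} {S.after r c} (v-lb (S.after r c) (proj₁ (isValAfter N τ r c))) ,
    ⊑-trans (S.after-min r c c′ (≤-near c c′ t cc′)) (proj₂ (isVal-unique N (tail τ) r c′ v v-val))
    where
    t : ℝ
    t = proj₁ (head τ)
    module S = Step t (nonNeg (head τ)) (payoff (toList (tail τ)))

  isVal-list : ∀ τ r c → IsVal r c (length τ) (fromList τ) (val τ r c)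
  isVal-list τ r c = subst (λ σ → IsVal r c (length τ) (fromList τ) (val σ r c)) (tabulate-lookup τ)
    (isVal (length τ) (fromList τ) r c)

-- Refinement of agilities

total : List ℝ₊ → ℝ
total []      = 0ℝ
total (t ∷ τ) = proj₁ t ⊕ total τ

totalTime≡total : ∀ {N} (τ : FiniteAgility N) → totalTime τ ≡ total (toList τ)
totalTime≡total {zero}  τ = refl
totalTime≡total {suc N} τ = trans (cong (λ w → proj₁ (head τ) + w) (totalTime≡total (tail τ)))
  (sym (⊕≡+ (proj₁ (head τ)) (total (toList (tail τ)))))

total≡totalTime : ∀ τ → total τ ≡ totalTime (fromList τ)
total≡totalTime τ = sym (trans (totalTime≡total (fromList τ)) (cong total (tabulate-lookup τ)))

⊕-cancelˡ-⊑ : ∀ {x y} z → z ⊕ x ⊑ z ⊕ y → x ⊑ y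
⊕-cancelˡ-⊑ {x} {y} z le = ⊕-cancelʳ-⊑ z (⊑-trans (proj₁ (⊕-comm x z)) (⊑-trans le (proj₁ (⊕-comm z y))))

module Refinement {a ℓ : Level} (em : ExcludedMiddle a) (M : MetricSpace a ℓ)
                  (compact : IsCompact M) (geodesic : IsGeodesic M)
                  (k : ℕ) .{{k≢0 : NonZero k}} where
  open Classical em
  open Values em M compact geodesic k

  total-nonNeg : ∀ τ → 0ℝ ⊑ total τ
  total-nonNeg []      = ⊑-refl
  total-nonNeg (t ∷ τ) = ⊕-nonNeg (nonNeg t) (total-nonNeg τ)

  total-++ : ∀ σ τ → total (σ ++ τ) ≋ total σ ⊕ total τ
  total-++ []      τ = ≋-sym (⊕-identityˡ (total τ))
  total-++ (t ∷ σ) τ = ≋-trans (⊕-cong ≋-refl (total-++ σ τ)) (≋-sym (⊕-assoc (proj₁ t) (total σ) (total τ)))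

  infix 4 _≼_

  _≼_ : List ℝ₊ → List ℝ₊ → Set a
  τ ≼ σ = payoff τ ⊴ payoff σ

  ∷-mono-≼ : ∀ t {τ σ} → τ ≼ σ → t ∷ τ ≼ t ∷ σ
  ∷-mono-≼ t = step-mono (nonNeg t)

  ++-monoʳ-≼ : ∀ ρ {τ σ} → τ ≼ σ → ρ ++ τ ≼ ρ ++ σ
  ++-monoʳ-≼ []      τ≼σ = τ≼σ
  ++-monoʳ-≼ (t ∷ ρ) {τ} {σ} τ≼σ = ∷-mono-≼ t {ρ ++ τ} {ρ ++ σ} (++-monoʳ-≼ ρ τ≼σ)

  ≼-[] : ∀ τ → τ ≼ []
  ≼-[] []      = ⊴-refl
  ≼-[] (t ∷ τ) = ⊴-trans (∷-mono-≼ t {τ} {[]} (≼-[] τ)) (step-distance (nonNeg t))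

  -- The appended steps act innermost, directly on the terminal distance; monotonicity of a step
  -- carries the comparison outwards.
  ++-≼ : ∀ σ τ → σ ++ τ ≼ σ
  ++-≼ []      τ = ≼-[] τ
  ++-≼ (t ∷ σ) τ = ∷-mono-≼ t {σ ++ τ} {σ} (++-≼ σ τ)

  split : ∀ (s t u : ℝ₊) τ → proj₁ s ⊕ proj₁ t ≋ proj₁ u → u ∷ τ ≼ s ∷ t ∷ τ
  split s t u τ s+t≋u = step-split (nonNeg s) (nonNeg t) (nonNeg u) s+t≋u (payoff τ)

  toℝ₊ : ∀ {x} → 0ℝ ⊑ x → ℝ₊
  toℝ₊ {x} 0⊑x = x , ⊑⇒≤ {0ℝ} {x} 0⊑x

  -- Makes `T` a boundary between steps by splitting the one step during which `T` falls.
  cut : ∀ σ {T} → 0ℝ ⊑ T → T ⊑ total σ →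
        ∃₂ λ σ₁ σ₂ → σ ≼ σ₁ ++ σ₂ × total σ₁ ≋ T × T ⊕ total σ₂ ≋ total σ
  cut [] {T} 0⊑T T⊑0 = [] , [] , ⊴-refl , (0⊑T , T⊑0) , ≋-trans (⊕-identityʳ T) (T⊑0 , 0⊑T)
  cut (s ∷ σ) {T} 0⊑T T⊑ = [ short , long ]′ (⊑-or-⊐ T (proj₁ s))
    where
    short : T ⊑ proj₁ s → ∃₂ λ σ₁ σ₂ → s ∷ σ ≼ σ₁ ++ σ₂ × total σ₁ ≋ T × T ⊕ total σ₂ ≋ total (s ∷ σ)
    short T⊑s = let u , 0⊑u , T+u≋s = difference T⊑s in
      toℝ₊ 0⊑T ∷ [] , toℝ₊ 0⊑u ∷ σ , split (toℝ₊ 0⊑T) (toℝ₊ 0⊑u) s σ T+u≋s ,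
      ⊕-identityʳ T , ≋-trans (≋-sym (⊕-assoc T u (total σ))) (⊕-cong T+u≋s ≋-refl)
    long : proj₁ s ⊏ T → ∃₂ λ σ₁ σ₂ → s ∷ σ ≼ σ₁ ++ σ₂ × total σ₁ ≋ T × T ⊕ total σ₂ ≋ total (s ∷ σ)
    long s⊏T =
      let u , 0⊑u , s+u≋T = difference (⊏⇒⊑ s⊏T)
          σ₁ , σ₂ , le , total₁ , total₂ = cut σ 0⊑u (⊕-cancelˡ-⊑ (proj₁ s) (⊑-trans (proj₁ s+u≋T) T⊑))
      in s ∷ σ₁ , σ₂ , ∷-mono-≼ s {σ} {σ₁ ++ σ₂} le , ≋-trans (⊕-cong ≋-refl total₁) s+u≋T ,
         ≋-trans (⊕-cong (≋-sym s+u≋T) ≋-refl)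
           (≋-trans (⊕-assoc (proj₁ s) u (total σ₂)) (⊕-cong ≋-refl total₂))

  -- Iterated splitting: the first piece is detached and the others are held in a single step of
  -- length `total σ` for the recursion.
  subdivide : ∀ t σ τ → total σ ≋ proj₁ t → t ∷ τ ≼ σ ++ τ
  subdivide t []      τ (_ , t⊑0) = step-zero (nonNeg t) t⊑0 (payoff τ)
  subdivide t (s ∷ σ) τ total≋t = ⊴-trans (split s rest t τ total≋t)
    (∷-mono-≼ s {rest ∷ τ} {σ ++ τ} (subdivide rest σ τ ≋-refl))
    where
    rest : ℝ₊
    rest = toℝ₊ (total-nonNeg σ)

  -- Cutting `σ` at the end of the first step of `τ` leaves an initial part that subdivides this
  -- step and a remainder with the same total as the rest of `τ`.
  common-refinement : ∀ τ σ → total τ ≋ total σ → ∃ λ ρ → τ ≼ ρ × σ ≼ ρ × total ρ ≋ total τ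
  common-refinement [] σ _ = [] , ⊴-refl , ≼-[] σ , ≋-refl
  common-refinement (t ∷ τ) σ eq =
    let σ₁ , σ₂ , σ≼ , total₁ , total₂ = cut σ (nonNeg t)
          (⊑-trans (x⊑x⊕y (proj₁ t) (total-nonNeg τ)) (proj₁ eq))
        t+τ≋t+σ₂ = ≋-trans eq (≋-sym total₂)
        ρ , τ≼ρ , σ₂≼ρ , totalρ = common-refinement τ σ₂
          (⊕-cancelˡ-⊑ (proj₁ t) (proj₁ t+τ≋t+σ₂) , ⊕-cancelˡ-⊑ (proj₁ t) (proj₂ t+τ≋t+σ₂))
    in σ₁ ++ ρ ,
       ⊴-trans (∷-mono-≼ t {τ} {ρ} τ≼ρ) (subdivide t σ₁ ρ total₁) ,
       ⊴-trans σ≼ (++-monoʳ-≼ σ₁ {σ₂} {ρ} σ₂≼ρ) ,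
       ≋-trans (total-++ σ₁ ρ) (⊕-cong total₁ totalρ)

-- Limit values and uniform approximation

halve : ∀ {h} → 0ℚ ℚ.< h → ∃ λ e → 0ℚ ℚ.< e × fromℚ e ⊕ fromℚ e ⊑ fromℚ h
halve {h} 0<h = h ℚ.* ½ , half-pos 0<h , proj₁ (fromℚ-+-≡ {h ℚ.* ½} {h} {h ℚ.* ½} (ε/2+ε/2≡ε h))

module LimitValue {a ℓ : Level} (em : ExcludedMiddle a) (M : MetricSpace a ℓ)
                  (compact : IsCompact M) (geodesic : IsGeodesic M)
                  (k : ℕ) .{{k≢0 : NonZero k}} where
  open Completeness em
  open Metric M
  open CompactSpace em M compact
  open Values em M compact geodesic k
  open Refinement em M compact geodesic k
  open Game M k

  module _ (r : X) (c : Vector X k) where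

    Reached : ℝ → Pred ℝ a
    Reached T v = ∃₂ λ N (τ : FiniteAgility N) → totalTime τ ≃ T × IsVal r c N τ v

    reached : ∀ τ T → total τ ≋ T → Reached T (val τ r c)
    reached τ T (le , ge) = length τ , fromList τ ,
      (⊑⇒≤ {totalTime (fromList τ)} {T} (subst (_⊑ T) (total≡totalTime τ) le) ,
       ⊑⇒≤ {T} {totalTime (fromList τ)} (subst (T ⊑_) (total≡totalTime τ) ge)) ,
      isVal-list τ r c

    reached⁻¹ : ∀ T v → Reached T v → ∃ λ τ → total τ ≋ T × v ≋ val τ r c
    reached⁻¹ T v (N , τ , (le , ge) , isval) = toList τ ,
      (subst (_⊑ T) (totalTime≡total τ) (≤⇒⊑ {totalTime τ} {T} le) ,
       subst (T ⊑_) (totalTime≡total τ) (≤⇒⊑ {T} {totalTime τ} ge)) ,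
      isVal-unique N τ r c v isval

    opaque
      -- A single step of length `T` shows that the set is inhabited; the initial distance bounds
      -- it, since every agility is below the empty one.
      within : ∀ {T} → 0ℝ ⊑ T → ∃ (IsValWithin r c T)
      within {T} 0⊑T = sup-exists (Reached T) (distToCops r c)
        (val (toℝ₊ 0⊑T ∷ []) r c , reached (toℝ₊ 0⊑T ∷ []) T (⊕-identityʳ T))
        λ v v∈ → let τ , _ , v⊑ , _ = reached⁻¹ T v v∈ in
          ⊑⇒≤ {v} {distToCops r c} (⊑-trans v⊑ (at-⊑ (≼-[] τ) r c))

    W : ∀ {T} → 0ℝ ⊑ T → ℝ
    W 0⊑T = proj₁ (within 0⊑T)

    val-⊑-sup : ∀ {T} w → IsValWithin r c T w → ∀ τ → total τ ≋ T → val τ r c ⊑ w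
    val-⊑-sup {T} w w-sup τ eq = ≤⇒⊑ {val τ r c} {w} (proj₁ w-sup (val τ r c) (reached τ T eq))

    val-⊑-W : ∀ {T} (p : 0ℝ ⊑ T) τ → total τ ≋ T → val τ r c ⊑ W p
    val-⊑-W p = val-⊑-sup (W p) (proj₂ (within p))

    W-least : ∀ {T} (p : 0ℝ ⊑ T) b → (∀ τ → total τ ≋ T → val τ r c ⊑ b) → W p ⊑ b
    W-least {T} p b bound = ≤⇒⊑ {W p} {b} (proj₂ (proj₂ (within p)) b λ v v∈ →
      let τ , eq , v⊑ , _ = reached⁻¹ T v v∈ in ⊑⇒≤ {v} {b} (⊑-trans v⊑ (bound τ eq)))

    W-approx : ∀ {T} (p : 0ℝ ⊑ T) {e} → 0ℚ ℚ.< e → ∃ λ τ → total τ ≋ T × W p ⊑ val τ r c ⊕ fromℚ e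
    W-approx {T} p {e} 0<e =
      let v , v∈ , W⊑ = sup-approx (Reached T) {W p} (proj₂ (within p)) {e} 0<e
          τ , eq , v⊑ , _ = reached⁻¹ T v v∈
      in τ , eq , ⊑-trans W⊑ (⊕-monoˡ (fromℚ e) v⊑)

    -- An agility of the longer time is cut at `S`, and dropping what follows favours the robber.
    W-anti : ∀ {S T} (p : 0ℝ ⊑ S) (q : 0ℝ ⊑ T) → S ⊑ T → W q ⊑ W p
    W-anti p q S⊑T = W-least q (W p) λ τ eq →
      let τ₁ , τ₂ , τ≼ , total₁ , _ = cut τ p (⊑-trans S⊑T (proj₂ eq))
      in ⊑-trans (at-⊑ (⊴-trans τ≼ (++-≼ τ₁ τ₂)) r c) (val-⊑-W p τ₁ total₁)

    Limits : Pred ℝ a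
    Limits v = ∃ λ T → 0ℝ < T × IsValWithin r c T v

    within∈Limits : ∀ {T} (0⊏T : 0ℝ ⊏ T) → Limits (W (⊏⇒⊑ 0⊏T))
    within∈Limits {T} 0⊏T = T , ⊏⇒< {0ℝ} {T} 0⊏T , proj₂ (within (⊏⇒⊑ 0⊏T))

    opaque
      limit : ∀ {T} → 0ℝ ⊏ T → ∃ (IsLimitVal r c)
      limit 0⊏T = inf-exists Limits 0ℝ (W (⊏⇒⊑ 0⊏T) , within∈Limits 0⊏T) λ { v (T , 0<T , v-sup) →
        let 0⊑T = ⊏⇒⊑ (<⇒⊏ {0ℝ} {T} 0<T) in
        ⊑⇒≤ {0ℝ} {v} (⊑-trans (val-nonNeg (toℝ₊ 0⊑T ∷ []) r c)
          (val-⊑-sup v v-sup (toℝ₊ 0⊑T ∷ []) (⊕-identityʳ T))) }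

  module _ {T₀ : ℝ} (0⊏T₀ : 0ℝ ⊏ T₀) where

    V : X → Vector X k → ℝ
    V r c = proj₁ (limit r c 0⊏T₀)

    V-⊑-W : ∀ r c {T} (0⊏T : 0ℝ ⊏ T) → V r c ⊑ W r c (⊏⇒⊑ 0⊏T)
    V-⊑-W r c 0⊏T = ≤⇒⊑ {V r c} {W r c (⊏⇒⊑ 0⊏T)}
      (proj₁ (proj₂ (limit r c 0⊏T₀)) (W r c (⊏⇒⊑ 0⊏T)) (within∈Limits r c 0⊏T))

    V-approx : ∀ r c {e} → 0ℚ ℚ.< e → ∃ λ T → Σ (0ℝ ⊏ T) λ 0⊏T → W r c (⊏⇒⊑ 0⊏T) ⊑ V r c ⊕ fromℚ e
    V-approx r c {e} 0<e =
      let v , (T , 0<T , v-sup) , v⊑ = inf-approx (Limits r c) {V r c} (proj₂ (limit r c 0⊏T₀)) {e} 0<e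
          0⊏T = <⇒⊏ {0ℝ} {T} 0<T
      in T , 0⊏T , ⊑-trans (W-least r c (⊏⇒⊑ 0⊏T) v (val-⊑-sup r c v v-sup)) v⊑

    module _ {e : ℚ} (0<e : 0ℚ ℚ.< e) where

      private
        E = fromℚ e

      val-lip : ∀ τ r r′ c c′ → d r r′ ⊑ E → Near E c c′ → val τ r c ⊑ val τ r′ c′ ⊕ (E ⊕ E)
      val-lip τ r r′ c c′ = Payoff.lip (payoff τ) r r′ c c′ (fromℚ-nonNeg {e} 0<e) (fromℚ-nonNeg {e} 0<e)

      W-lip : ∀ r r′ c c′ → d r r′ ⊑ E → Near E c c′ → ∀ {T} (p : 0ℝ ⊑ T) → W r c p ⊑ W r′ c′ p ⊕ (E ⊕ E)
      W-lip r r′ c c′ rr′ cc′ p = W-least r c p (W r′ c′ p ⊕ (E ⊕ E)) λ τ eq →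
        ⊑-trans (val-lip τ r r′ c c′ rr′ cc′) (⊕-monoˡ (E ⊕ E) (val-⊑-W r′ c′ p τ eq))

      -- The third `E` pays for replacing the limit at the second position by the supremum at a
      -- single time.
      V-lip : ∀ r r′ c c′ → d r r′ ⊑ E → Near E c c′ → V r c ⊑ (V r′ c′ ⊕ E) ⊕ (E ⊕ E)
      V-lip r r′ c c′ rr′ cc′ =
        let T , 0⊏T , W⊑V = V-approx r′ c′ {e} 0<e
        in ⊑-trans (V-⊑-W r c 0⊏T) (⊑-trans (W-lip r r′ c c′ rr′ cc′ (⊏⇒⊑ 0⊏T)) (⊕-monoˡ (E ⊕ E) W⊑V))

      -- Of the six `E`, two move `W` to a nearby good position, one is the accuracy there, and
      -- three move `V` back.
      uniform-time : ∃ λ T → Σ (T₀ ⊑ T) λ T₀⊑T → ∀ r c →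
        W r c (⊏⇒⊑ (⊏-⊑-trans 0⊏T₀ T₀⊑T)) ⊑ V r c ⊕ ((E ⊕ E) ⊕ (E ⊕ E) ⊕ (E ⊕ E))
      uniform-time = let (T , T₀⊑T) , near-good = uniform (suc k) P stable late {e} 0<e in
        T , T₀⊑T , λ r c → spread r c (pos T₀⊑T) (near-good (r Vector.∷ c))
        where
        Time : Set
        Time = ∃ λ T → T₀ ⊑ T
        pos : ∀ {T} → T₀ ⊑ T → 0ℝ ⊏ T
        pos = ⊏-⊑-trans 0⊏T₀
        -- Since both times are positive, their sum lies above each of them, and `W` does not
        -- increase with time.
        _∨_ : Time → Time → Time
        (S , T₀⊑S) ∨ (T , T₀⊑T) = S ⊕ T , ⊑-trans T₀⊑S (x⊑x⊕y S (⊏⇒⊑ (pos T₀⊑T)))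
        open Uniform _∨_ (T₀ , ⊑-refl)
        P : Vector X (suc k) → Time → Set
        P v (T , T₀⊑T) = W (head v) (tail v) (⊏⇒⊑ (pos T₀⊑T)) ⊑ V (head v) (tail v) ⊕ E
        stable : ∀ v → Stable (P v)
        stable v =
          (λ { (S , T₀⊑S) (T , T₀⊑T) → ⊑-trans (W-anti (head v) (tail v) _ _
                 (x⊑x⊕y S (⊏⇒⊑ (pos T₀⊑T)))) }) ,
          (λ { (S , T₀⊑S) (T , T₀⊑T) → ⊑-trans (W-anti (head v) (tail v) _ _
                 (⊑-trans (x⊑x⊕y T (⊏⇒⊑ (pos T₀⊑S))) (proj₁ (⊕-comm T S)))) })
        late : ∀ v → ∃ (P v)
        late v =
          let T , 0⊏T , W⊑ = V-approx (head v) (tail v) {e} 0<e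
          in (T₀ ⊕ T , x⊑x⊕y T₀ (⊏⇒⊑ 0⊏T)) , ⊑-trans (W-anti (head v) (tail v) (⊏⇒⊑ 0⊏T) _
               (⊑-trans (x⊑x⊕y T (⊏⇒⊑ 0⊏T₀)) (proj₁ (⊕-comm T T₀)))) W⊑
        spread : ∀ r c {T} (0⊏T : 0ℝ ⊏ T) →
          (∃ λ w → Near E (r Vector.∷ c) w × W (head w) (tail w) (⊏⇒⊑ 0⊏T) ⊑ V (head w) (tail w) ⊕ E) →
          W r c (⊏⇒⊑ 0⊏T) ⊑ V r c ⊕ ((E ⊕ E) ⊕ (E ⊕ E) ⊕ (E ⊕ E))
        spread r c 0⊏T (w , vw , W⊑) = begin
          W r c (⊏⇒⊑ 0⊏T)
            ≤⟨ W-lip r (head w) c (tail w) (vw zero) (λ i → vw (suc i)) (⊏⇒⊑ 0⊏T) ⟩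
          W (head w) (tail w) (⊏⇒⊑ 0⊏T) ⊕ (E ⊕ E)
            ≤⟨ ⊕-monoˡ (E ⊕ E) W⊑ ⟩
          V (head w) (tail w) ⊕ E ⊕ (E ⊕ E)
            ≤⟨ ⊕-monoˡ (E ⊕ E) (⊕-monoˡ E (V-lip (head w) r (tail w) c
                 (⊑-trans (d-sym (head w) r) (vw zero))
                 (λ i → ⊑-trans (d-sym (tail w i) (c i)) (vw (suc i))))) ⟩
          V r c ⊕ E ⊕ (E ⊕ E) ⊕ E ⊕ (E ⊕ E)
            ≈⟨ ⊕-Solver.solve 2 (λ v e → (((v ⊕′ e) ⊕′ (e ⊕′ e)) ⊕′ e) ⊕′ (e ⊕′ e) ⊜
                                v ⊕′ (((e ⊕′ e) ⊕′ (e ⊕′ e)) ⊕′ (e ⊕′ e))) ≋-refl (V r c) E ⟩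
          V r c ⊕ ((E ⊕ E) ⊕ (E ⊕ E) ⊕ (E ⊕ E)) ∎

      -- Of the five `E`, two move `W` to a nearby good position, one is the accuracy there, and two
      -- move the value of the agility back.
      uniform-agility : ∀ {T} (p : 0ℝ ⊑ T) → ∃ λ τ → total τ ≋ T ×
        (∀ r c → W r c p ⊑ val τ r c ⊕ ((E ⊕ E) ⊕ (E ⊕ E) ⊕ E))
      uniform-agility {T} p = let (τ , eq) , near-good = uniform (suc k) P stable (λ v → found v) {e} 0<e in
        τ , eq , λ r c → spread r c τ (near-good (r Vector.∷ c))
        where
        Agility : Set
        Agility = ∃ λ τ → total τ ≋ T
        refine : ∀ (τ σ : Agility) → ∃ λ ρ → proj₁ τ ≼ ρ × proj₁ σ ≼ ρ × total ρ ≋ total (proj₁ τ)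
        refine (τ , eq) (σ , eq′) = common-refinement τ σ (≋-trans eq (≋-sym eq′))
        _∨_ : Agility → Agility → Agility
        τ ∨ σ = proj₁ (refine τ σ) , ≋-trans (proj₂ (proj₂ (proj₂ (refine τ σ)))) (proj₂ τ)
        open Uniform _∨_ (toℝ₊ p ∷ [] , ⊕-identityʳ T)
        P : Vector X (suc k) → Agility → Set
        P v (τ , _) = W (head v) (tail v) p ⊑ val τ (head v) (tail v) ⊕ E
        stable : ∀ v → Stable (P v)
        stable v =
          (λ τ σ Pτ → ⊑-trans Pτ (⊕-monoˡ E (at-⊑ (proj₁ (proj₂ (refine τ σ))) (head v) (tail v)))) ,
          (λ τ σ Pσ → ⊑-trans Pσ (⊕-monoˡ E (at-⊑ (proj₁ (proj₂ (proj₂ (refine τ σ)))) (head v) (tail v))))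
        found : ∀ v → ∃ (P v)
        found v = let τ , eq , W⊑ = W-approx (head v) (tail v) p {e} 0<e in (τ , eq) , W⊑
        spread : ∀ r c τ →
          (∃ λ w → Near E (r Vector.∷ c) w × W (head w) (tail w) p ⊑ val τ (head w) (tail w) ⊕ E) →
          W r c p ⊑ val τ r c ⊕ ((E ⊕ E) ⊕ (E ⊕ E) ⊕ E)
        spread r c τ (w , vw , W⊑) = begin
          W r c p
            ≤⟨ W-lip r (head w) c (tail w) (vw zero) (λ i → vw (suc i)) p ⟩
          W (head w) (tail w) p ⊕ (E ⊕ E)
            ≤⟨ ⊕-monoˡ (E ⊕ E) W⊑ ⟩
          val τ (head w) (tail w) ⊕ E ⊕ (E ⊕ E)
            ≤⟨ ⊕-monoˡ (E ⊕ E) (⊕-monoˡ E (val-lip τ (head w) r (tail w) c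
                 (⊑-trans (d-sym (head w) r) (vw zero))
                 (λ i → ⊑-trans (d-sym (tail w i) (c i)) (vw (suc i))))) ⟩
          val τ r c ⊕ (E ⊕ E) ⊕ E ⊕ (E ⊕ E)
            ≈⟨ ⊕-Solver.solve 2 (λ v e → ((v ⊕′ (e ⊕′ e)) ⊕′ e) ⊕′ (e ⊕′ e) ⊜
                                v ⊕′ (((e ⊕′ e) ⊕′ (e ⊕′ e)) ⊕′ e)) ≋-refl (val τ r c) E ⟩
          val τ r c ⊕ ((E ⊕ E) ⊕ (E ⊕ E) ⊕ E) ∎

    opaque
      approximation : ∀ {δ} → 0ℝ ⊏ δ → ∃ λ τ → T₀ ⊑ total τ × (∀ r c →
        V r c ⊏ val τ r c ⊕ δ × val τ r c ⊏ V r c ⊕ δ)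
      approximation {δ} 0⊏δ =
        let h , 0<h , h⊏δ = ⊏-dense 0⊏δ
            -- Three halvings give eight `E` below `h`, enough for the six of `uniform-time`.
            h₄ , 0<h₄ , le₄ = halve {h} 0<h
            h₂ , 0<h₂ , le₂ = halve {h₄} 0<h₄
            e , 0<e , le₁ = halve {h₂} 0<h₂
            E = fromℚ e
            0⊑E = fromℚ-nonNeg {e} 0<e
            6E⊏δ = ⊑-⊏-trans (⊑-trans (x⊑x⊕y ((E ⊕ E) ⊕ (E ⊕ E) ⊕ (E ⊕ E)) (⊕-nonNeg 0⊑E 0⊑E))
              (⊑-trans (proj₁ (⊕-assoc ((E ⊕ E) ⊕ (E ⊕ E)) (E ⊕ E) (E ⊕ E)))
              (⊑-trans (⊕-mono-⊑ (⊑-trans (⊕-mono-⊑ le₁ le₁) le₂) (⊑-trans (⊕-mono-⊑ le₁ le₁) le₂)) le₄))) h⊏δ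
            5E⊏δ = ⊑-⊏-trans (⊕-monoʳ ((E ⊕ E) ⊕ (E ⊕ E)) (x⊑x⊕y E 0⊑E)) 6E⊏δ
            T , T₀⊑T , W⊑V = uniform-time {e} 0<e
            0⊏T = ⊏-⊑-trans 0⊏T₀ T₀⊑T
            τ , eq , W⊑val = uniform-agility {e} 0<e (⊏⇒⊑ 0⊏T)
        in τ , ⊑-trans T₀⊑T (proj₂ eq) , λ r c →
           ⊑-⊏-trans (⊑-trans (V-⊑-W r c 0⊏T) (W⊑val r c)) (⊕-monoʳ-⊏ (val τ r c) 5E⊏δ) ,
           ⊑-⊏-trans (⊑-trans (val-⊑-W r c (⊏⇒⊑ 0⊏T) τ eq) (W⊑V r c)) (⊕-monoʳ-⊏ (V r c) 6E⊏δ)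

-- Return to the original order relations

x⊏y⊕z⇒x-z<y : ∀ {x y z} → x ⊏ y ⊕ z → x - z < y
x⊏y⊕z⇒x-z<y {x} {y} {z} lt = ⊏⇒< {x - z} {y} (subst (_⊏ y) (⊕≡+ x (- z))
  (⊕-cancelʳ-⊏ z (⊑-⊏-trans (proj₁ (x-y+y≋x x z)) lt)))

corollary7 : ∀ {a ℓ} → ExcludedMiddle a →
    (M : MetricSpace a ℓ) → IsCompact M → IsGeodesic M →
    (k : ℕ) .{{_ : NonZero k}} →
    (ε T : ℝ) → 0ℝ < ε → 0ℝ < T →
    Σ[ N ∈ ℕ ] Σ[ τ ∈ FiniteAgility N ] (T ≤ totalTime τ ×
    ((r : MetricSpace.Carrier M) (c : Vector (MetricSpace.Carrier M) k) →
    ∃[ V ] ∃[ v ] (Game.IsLimitVal M k r c V × Game.IsVal M k r c N τ v ×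
    V - ε < v × v < V + ε)))
corollary7 em M compact geodesic k ε T 0<ε 0<T =
  length τ , fromList τ , ⊑⇒≤ {T} {totalTime (fromList τ)} (subst (T ⊑_) (total≡totalTime τ) (proj₁ (proj₂ approx))) ,
  λ r c → V 0⊏T r c , val τ r c , proj₂ (limit r c 0⊏T) ,
    isVal-list τ r c ,
    x⊏y⊕z⇒x-z<y {V 0⊏T r c} {val τ r c} {ε} (proj₁ (proj₂ (proj₂ approx) r c)) ,
    ⊏⇒< {val τ r c} {V 0⊏T r c + ε} (subst (val τ r c ⊏_) (⊕≡+ (V 0⊏T r c) ε) (proj₂ (proj₂ (proj₂ approx) r c)))
  where
  open Values em M compact geodesic k
  open LimitValue em M compact geodesic k
  0⊏T : 0ℝ ⊏ T
  0⊏T = <⇒⊏ {0ℝ} {T} 0<T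
  approx : ∃ λ τ → T ⊑ total τ × (∀ r c → V 0⊏T r c ⊏ val τ r c ⊕ ε × val τ r c ⊏ V 0⊏T r c ⊕ ε)
  approx = approximation 0⊏T (<⇒⊏ {0ℝ} {ε} 0<ε)
  τ : List ℝ₊
  τ = proj₁ approx
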